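{- Let $\mathbb K$ be a field of characteristic $p>2$ with prime subfield $\mathbb F_p$, $n,r\ge1$, $\Lambda_1,\dots,\Lambda_n\in\mathbb F_p$, $a\in\mathbb F_p^\times$, $\kappa=1$. The function $$F(s,x)=\prod_{m=1}^n\prod_{l=1}^r g(s_l-x_m,\Lambda_m)\cdot\prod_{1\le j<l\le r}\bigl((s_l-s_j)\,g(s_l-s_j+1,-2)\bigr)$$ is a polynomial in $s=(s_1,\dots,s_r)$ and $x=(x_1,\dots,x_n)$. Furthermore, $F$ is a master function for the connection $(\Phi_l,\Psi_m)$, that is, $$\Phi_l(s,x)=\frac{F(s+ae_l,x)}{F(s,x)},\qquad\Psi_m(s,x)=\frac{F(s,x+af_m)}{F(s,x)}$$ for $l=1,\dots,r$ and $m=1,\dots,n$.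
   Context: For $b\in\mathbb F_p$ let $\bar b\in\{1,\dots,p\}$ be such that $a\bar b=b$ in $\mathbb F_p$, and set $g(y,b)=(y+b-a)\cdots(y+2a)(y+a)$, the product of the $\bar b-1$ factors $y+ia$, $i=1,\dots,\bar b-1$. With $\kappa=1$, $$\Phi_l(s,x)=\prod_{i=1}^n\frac{s_l-x_i+\Lambda_i}{s_l-x_i+a}\prod_{j\ne l}\frac{(s_l-s_j+a)(s_l-s_j-1)}{(s_l-s_j)(s_l-s_j+1+a)},\qquad \Psi_m(s,x)=\prod_{j=1}^r\frac{s_j-x_m}{s_j-x_m+\Lambda_m-a}.$$ Here $s+ae_l$ (resp. $x+af_m$) is $s$ (resp. $x$) with the $l$-th (resp. $m$-th) coordinate increased by $a$. -}

module Defs where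

open import Algebra.Apartness.Bundles using (HeytingCommutativeRing; HeytingField)
open import Algebra.Bundles using (CommutativeMonoid; CommutativeRing; Semiring)
open import Algebra.Structures using (IsCommutativeMonoid; IsCommutativeRing)
open import Data.Fin.Base using (Fin; zero; suc; toℕ; splitAt; _↑ˡ_; _↑ʳ_)
open import Data.Fin.Properties as Fin using (splitAt-↑ˡ; splitAt-↑ʳ; ↑ˡ-injective)
open import Data.List.Base using (List; []; _∷_; map)
open import Data.Nat.Base as ℕ using (ℕ; zero; suc; s≤s; z≤n)
open import Data.Nat.Divisibility as ∣ using (_∣_; divides)
open import Data.Nat.DivMod using (_%_; m%n<n; m≡m%n+[m/n]*n)
open import Data.Nat.GCD using (gcd; gcd[m,n]∣m; gcd[m,n]∣n; gcd-GCD; module Bézout)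
import Data.Nat.Properties as ℕ
open import Data.Product.Base using (∃-syntax; Σ-syntax; _×_; _,_; proj₁; proj₂)
open import Data.Sum.Base using (_⊎_; inj₁; inj₂)
open import Data.Vec.Functional using (Vector; updateAt)
open import Function.Base using (_∘′_)
open import Function.Bundles using (_⇔_; Equivalence)
open import Level using (Level; _⊔_) renaming (suc to lsuc)
open import Relation.Binary.PropositionalEquality.Core as ≡ using (_≡_; _≢_)
open import Relation.Binary.Structures using (IsEquivalence)
open import Relation.Nullary.Decidable.Core using (Dec; yes; no; ¬?)
open import Relation.Nullary.Negation.Core using (¬_; contradiction)
import Algebra.Apartness.Properties.HeytingCommutativeRing as HeytingProperties
import Algebra.Definitions.RawSemiring as RawSemiring
import Algebra.Properties.CommutativeSemigroup as CommutativeSemigroupProperties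
import Algebra.Properties.Ring as RingProperties
import Algebra.Properties.Semiring.Mult as Multiples
import Algebra.Solver.Ring.NaturalCoefficients.Default as SemiringSolver
import Relation.Binary.Reasoning.Setoid as ≈-Reasoning

private variable
  c ℓ₁ ℓ₂ : Level

-- Integral domains, with nonzeroness given as a positive predicate
-- (classically, x #0 is just the negation of x ≈ 0#).
record ApartnessDomain c ℓ₁ ℓ₂ : Set (lsuc (c ⊔ ℓ₁ ⊔ ℓ₂)) where
  infix 4 _#0
  field
    commutativeRing : CommutativeRing c ℓ₁

  open CommutativeRing commutativeRing public

  field
    _#0      : Carrier → Set ℓ₂
    #0-resp  : ∀ {x y} → x ≈ y → x #0 → y #0
    #0-+     : ∀ {x y} → x + y #0 → x #0 ⊎ y #0
    #0-*ˡ    : ∀ {x y} → x * y #0 → x #0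
    #0-*     : ∀ {x y} → x #0 → y #0 → x * y #0
    1#0      : 1# #0
    0-¬#0    : ¬ 0# #0
    #0-tight : ∀ {x} → ¬ x #0 → x ≈ 0#

module DomainProperties (D : ApartnessDomain c ℓ₁ ℓ₂) where
  open ApartnessDomain D
  open RingProperties ring

  #0-*ʳ : ∀ {x y} → x * y #0 → y #0
  #0-*ʳ {x} {y} = #0-*ˡ ∘′ #0-resp (*-comm x y)

  #0-neg : ∀ {x} → x #0 → - x #0
  #0-neg {x} x#0 =
    #0-*ˡ (#0-resp (trans (sym (-‿involutive x))
                   (trans (-‿cong (sym (*-identityʳ (- x)))) (-‿distribʳ-* (- x) 1#))) x#0)

  x-y≈0⇒x≈y : ∀ {x y} → x - y ≈ 0# → x ≈ y
  x-y≈0⇒x≈y {x} {y} eq = trans (+-inverseˡ-unique x (- y) eq) (-‿involutive y)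

  *-cancelʳ : ∀ {x y z} → z #0 → x * z ≈ y * z → x ≈ y
  *-cancelʳ {x} {y} {z} z#0 eq = x-y≈0⇒x≈y (#0-tight λ d#0 → 0-¬#0 (#0-resp vanishes (#0-* d#0 z#0)))
    where
    open ≈-Reasoning setoid
    vanishes : (x - y) * z ≈ 0#
    vanishes = begin
      (x - y) * z        ≈⟨ distribʳ z x (- y) ⟩
      x * z + - y * z    ≈⟨ +-cong eq (sym (-‿distribˡ-* y z)) ⟩
      y * z - y * z      ≈⟨ -‿inverseʳ (y * z) ⟩
      0#                 ∎

fieldDomain : HeytingField c ℓ₁ ℓ₂ → ApartnessDomain c ℓ₁ ℓ₂
fieldDomain K = record
  { commutativeRing = commutativeRing
  ; _#0      = _# 0#
  ; #0-resp  = #-congʳ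
  ; #0-+     = sum#0
  ; #0-*ˡ    = factor#0
  ; #0-*     = x#0y#0→xy#0
  ; 1#0      = P.1#0
  ; 0-¬#0    = #-irrefl refl
  ; #0-tight = λ {x} → proj₁ (tight x 0#)
  }
  where
  open HeytingField K
  open HeytingCommutativeRing heytingCommutativeRing using (commutativeRing)
  open CommutativeRing commutativeRing using (ring)
  open RingProperties ring using (-0#≈0#)
  module P = HeytingProperties heytingCommutativeRing
  open P using (#-congʳ; #-congˡ; x#0y#0→xy#0; invertibleʳ⇒#; x-0≈x)
  open ≈-Reasoning setoid

  sum#0 : ∀ {x y} → x + y # 0# → x # 0# ⊎ y # 0#
  sum#0 {x} {y} h with #-cotrans h y
  ... | inj₂ y#0 = inj₂ y#0
  ... | inj₁ s#y with #⇒invertible s#y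
  ...   | i , _ , eq = inj₁ (invertibleʳ⇒# (i , trans (*-congʳ same) eq))
    where
    same : x - 0# ≈ (x + y) - y
    same = begin
      x - 0#         ≈⟨ x-0≈x x ⟩
      x              ≈⟨ +-identityʳ x ⟨
      x + 0#         ≈⟨ +-congˡ (-‿inverseʳ y) ⟨
      x + (y - y)    ≈⟨ +-assoc x y (- y) ⟨
      (x + y) - y    ∎

  factor#0 : ∀ {x y} → x * y # 0# → x # 0#
  factor#0 {x} {y} h with #⇒invertible h
  ... | i , _ , eq = invertibleʳ⇒# (y * i , (begin
    (x - 0#) * (y * i)    ≈⟨ *-congʳ (x-0≈x x) ⟩
    x * (y * i)           ≈⟨ *-assoc x y i ⟨
    x * y * i             ≈⟨ *-congʳ (x-0≈x (x * y)) ⟨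
    (x * y - 0#) * i      ≈⟨ eq ⟩
    1#                    ∎))

-- Polynomials in one variable: coefficient lists, lowest degree first.
-- Trailing zeros are allowed, so equality is equality of coefficients.
module Polynomial (D : ApartnessDomain c ℓ₁ ℓ₂) where
  open ApartnessDomain D
  open DomainProperties D
  open RingProperties ring using (-0#≈0#)

  Poly : Set c
  Poly = List Carrier

  coeff : Poly → ℕ → Carrier
  coeff []      _       = 0#
  coeff (a ∷ p) zero    = a
  coeff (a ∷ p) (suc k) = coeff p k

  infix 4 _≈ᴾ_
  record _≈ᴾ_ (p q : Poly) : Set ℓ₁ where
    constructor coeffwise
    field at : ∀ k → coeff p k ≈ coeff q k
  open _≈ᴾ_ public

  infixl 6 _+ᴾ_
  infixl 7 _*ᴾ_ _·_

  _+ᴾ_ : Poly → Poly → Poly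
  []      +ᴾ q       = q
  (a ∷ p) +ᴾ []      = a ∷ p
  (a ∷ p) +ᴾ (b ∷ q) = (a + b) ∷ (p +ᴾ q)

  -ᴾ_ : Poly → Poly
  -ᴾ_ = map (λ a → - a)

  _·_ : Carrier → Poly → Poly
  a · p = map (a *_) p

  _*ᴾ_ : Poly → Poly → Poly
  []      *ᴾ q = []
  (a ∷ p) *ᴾ q = a · q +ᴾ (0# ∷ p *ᴾ q)

  C : Carrier → Poly
  C a = a ∷ []

  X : Poly
  X = 0# ∷ 1# ∷ []

  coeff-+ : ∀ p q k → coeff (p +ᴾ q) k ≈ coeff p k + coeff q k
  coeff-+ []      q       k       = sym (+-identityˡ _)
  coeff-+ (a ∷ p) []      k       = sym (+-identityʳ _)
  coeff-+ (a ∷ p) (b ∷ q) zero    = refl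
  coeff-+ (a ∷ p) (b ∷ q) (suc k) = coeff-+ p q k

  coeff-neg : ∀ p k → coeff (-ᴾ p) k ≈ - coeff p k
  coeff-neg []      k       = sym -0#≈0#
  coeff-neg (a ∷ p) zero    = refl
  coeff-neg (a ∷ p) (suc k) = coeff-neg p k

  coeff-· : ∀ a p k → coeff (a · p) k ≈ a * coeff p k
  coeff-· a []      k       = sym (zeroʳ a)
  coeff-· a (b ∷ p) zero    = refl
  coeff-· a (b ∷ p) (suc k) = coeff-· a p k

  ≈ᴾ-isEquivalence : IsEquivalence _≈ᴾ_
  ≈ᴾ-isEquivalence = record
    { refl  = coeffwise λ k → refl
    ; sym   = λ e → coeffwise λ k → sym (at e k)
    ; trans = λ e f → coeffwise λ k → trans (at e k) (at f k)
    }

  open IsEquivalence ≈ᴾ-isEquivalence public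
    renaming (refl to reflᴾ; sym to symᴾ; trans to transᴾ)

  +ᴾ-cong : ∀ {p p′ q q′} → p ≈ᴾ p′ → q ≈ᴾ q′ → p +ᴾ q ≈ᴾ p′ +ᴾ q′
  +ᴾ-cong {p} {p′} {q} {q′} e f = coeffwise λ k →
    trans (coeff-+ p q k) (trans (+-cong (at e k) (at f k)) (sym (coeff-+ p′ q′ k)))

  +ᴾ-assoc : ∀ p q r → (p +ᴾ q) +ᴾ r ≈ᴾ p +ᴾ (q +ᴾ r)
  +ᴾ-assoc p q r = coeffwise λ k →
    trans (coeff-+ (p +ᴾ q) r k) (trans (+-congʳ (coeff-+ p q k)) (trans (+-assoc _ _ _)
      (sym (trans (coeff-+ p (q +ᴾ r) k) (+-congˡ (coeff-+ q r k))))))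

  +ᴾ-comm : ∀ p q → p +ᴾ q ≈ᴾ q +ᴾ p
  +ᴾ-comm p q = coeffwise λ k →
    trans (coeff-+ p q k) (trans (+-comm _ _) (sym (coeff-+ q p k)))

  +ᴾ-identityʳ : ∀ p → p +ᴾ [] ≈ᴾ p
  +ᴾ-identityʳ p = coeffwise λ k → trans (coeff-+ p [] k) (+-identityʳ _)

  +ᴾ-isCommutativeMonoid : IsCommutativeMonoid _≈ᴾ_ _+ᴾ_ []
  +ᴾ-isCommutativeMonoid = record
    { isMonoid = record
      { isSemigroup = record
        { isMagma = record { isEquivalence = ≈ᴾ-isEquivalence ; ∙-cong = +ᴾ-cong }
        ; assoc = +ᴾ-assoc }
      ; identity = (λ p → reflᴾ) , +ᴾ-identityʳ }
    ; comm = +ᴾ-comm }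

  private
    +ᴾ-commutativeMonoid : CommutativeMonoid c ℓ₁
    +ᴾ-commutativeMonoid = record { isCommutativeMonoid = +ᴾ-isCommutativeMonoid }

    open CommutativeMonoid +ᴾ-commutativeMonoid using (commutativeSemigroup) renaming (setoid to setoidᴾ)
    open CommutativeSemigroupProperties commutativeSemigroup using (interchange; x∙yz≈y∙xz)

  -ᴾ-cong : ∀ {p q} → p ≈ᴾ q → -ᴾ p ≈ᴾ -ᴾ q
  -ᴾ-cong {p} {q} e = coeffwise λ k →
    trans (coeff-neg p k) (trans (-‿cong (at e k)) (sym (coeff-neg q k)))

  -ᴾ-inverseˡ : ∀ p → -ᴾ p +ᴾ p ≈ᴾ []
  -ᴾ-inverseˡ p = coeffwise λ k →
    trans (coeff-+ (-ᴾ p) p k) (trans (+-congʳ (coeff-neg p k)) (-‿inverseˡ _))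

  -ᴾ-inverseʳ : ∀ p → p +ᴾ -ᴾ p ≈ᴾ []
  -ᴾ-inverseʳ p = transᴾ (+ᴾ-comm p (-ᴾ p)) (-ᴾ-inverseˡ p)

  ∷-cong : ∀ {a b p q} → a ≈ b → p ≈ᴾ q → a ∷ p ≈ᴾ b ∷ q
  ∷-cong e f = coeffwise λ { zero → e ; (suc k) → at f k }

  0∷[]≈[] : 0# ∷ [] ≈ᴾ []
  0∷[]≈[] = coeffwise λ { zero → refl ; (suc k) → refl }

  ·-cong : ∀ {a b p q} → a ≈ b → p ≈ᴾ q → a · p ≈ᴾ b · q
  ·-cong {a} {b} {p} {q} e f = coeffwise λ k →
    trans (coeff-· a p k) (trans (*-cong e (at f k)) (sym (coeff-· b q k)))

  ·-distribˡ : ∀ a p q → a · (p +ᴾ q) ≈ᴾ a · p +ᴾ a · q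
  ·-distribˡ a p q = coeffwise λ k →
    trans (coeff-· a (p +ᴾ q) k) (trans (*-congˡ (coeff-+ p q k)) (trans (distribˡ a _ _)
      (sym (trans (coeff-+ (a · p) (a · q) k) (+-cong (coeff-· a p k) (coeff-· a q k))))))

  ·-distribʳ : ∀ a b p → (a + b) · p ≈ᴾ a · p +ᴾ b · p
  ·-distribʳ a b p = coeffwise λ k →
    trans (coeff-· (a + b) p k) (trans (distribʳ _ a b)
      (sym (trans (coeff-+ (a · p) (b · p) k) (+-cong (coeff-· a p k) (coeff-· b p k)))))

  ·-assoc : ∀ a b p → (a * b) · p ≈ᴾ a · (b · p)
  ·-assoc a b p = coeffwise λ k →
    trans (coeff-· (a * b) p k) (trans (*-assoc a b _)
      (sym (trans (coeff-· a (b · p) k) (*-congˡ (coeff-· b p k)))))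

  1·p≈p : ∀ p → 1# · p ≈ᴾ p
  1·p≈p p = coeffwise λ k → trans (coeff-· 1# p k) (*-identityˡ _)

  0·p≈[] : ∀ p → 0# · p ≈ᴾ []
  0·p≈[] p = coeffwise λ k → trans (coeff-· 0# p k) (zeroˡ _)

  *ᴾ-congˡ : ∀ p {q q′} → q ≈ᴾ q′ → p *ᴾ q ≈ᴾ p *ᴾ q′
  *ᴾ-congˡ []      e = reflᴾ
  *ᴾ-congˡ (a ∷ p) e = +ᴾ-cong (·-cong refl e) (∷-cong refl (*ᴾ-congˡ p e))

  *ᴾ-zeroʳ : ∀ p → p *ᴾ [] ≈ᴾ []
  *ᴾ-zeroʳ []      = reflᴾ
  *ᴾ-zeroʳ (a ∷ p) = transᴾ (∷-cong refl (*ᴾ-zeroʳ p)) 0∷[]≈[]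

  *ᴾ-∷ʳ : ∀ p b q → p *ᴾ (b ∷ q) ≈ᴾ b · p +ᴾ (0# ∷ p *ᴾ q)
  *ᴾ-∷ʳ []      b q = symᴾ 0∷[]≈[]
  *ᴾ-∷ʳ (a ∷ p) b q = ∷-cong (+-congʳ (*-comm a b))
    (transᴾ (+ᴾ-cong (reflᴾ {a · q}) (*ᴾ-∷ʳ p b q)) (x∙yz≈y∙xz (a · q) (b · p) (0# ∷ p *ᴾ q)))

  *ᴾ-comm : ∀ p q → p *ᴾ q ≈ᴾ q *ᴾ p
  *ᴾ-comm []      q = symᴾ (*ᴾ-zeroʳ q)
  *ᴾ-comm (a ∷ p) q = transᴾ (+ᴾ-cong (reflᴾ {a · q}) (∷-cong refl (*ᴾ-comm p q))) (symᴾ (*ᴾ-∷ʳ q a p))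

  *ᴾ-cong : ∀ {p p′ q q′} → p ≈ᴾ p′ → q ≈ᴾ q′ → p *ᴾ q ≈ᴾ p′ *ᴾ q′
  *ᴾ-cong {p} {p′} {q} {q′} e f = transᴾ (*ᴾ-congˡ p f)
    (transᴾ (*ᴾ-comm p q′) (transᴾ (*ᴾ-congˡ q′ e) (*ᴾ-comm q′ p′)))

  *ᴾ-distribʳ : ∀ r p q → (p +ᴾ q) *ᴾ r ≈ᴾ p *ᴾ r +ᴾ q *ᴾ r
  *ᴾ-distribʳ r []      q       = reflᴾ
  *ᴾ-distribʳ r (a ∷ p) []      = symᴾ (+ᴾ-identityʳ _)
  *ᴾ-distribʳ r (a ∷ p) (b ∷ q) = transᴾ
    (+ᴾ-cong (·-distribʳ a b r) (∷-cong (sym (+-identityˡ 0#)) (*ᴾ-distribʳ r p q)))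
    (interchange (a · r) (b · r) (0# ∷ p *ᴾ r) (0# ∷ q *ᴾ r))

  *ᴾ-distribˡ : ∀ r p q → r *ᴾ (p +ᴾ q) ≈ᴾ r *ᴾ p +ᴾ r *ᴾ q
  *ᴾ-distribˡ r p q = transᴾ (*ᴾ-comm r (p +ᴾ q))
    (transᴾ (*ᴾ-distribʳ r p q) (+ᴾ-cong (*ᴾ-comm p r) (*ᴾ-comm q r)))

  ·-*ᴾ : ∀ a p q → (a · p) *ᴾ q ≈ᴾ a · (p *ᴾ q)
  ·-*ᴾ a []      q = reflᴾ
  ·-*ᴾ a (b ∷ p) q = transᴾ
    (+ᴾ-cong (·-assoc a b q) (∷-cong (sym (zeroʳ a)) (·-*ᴾ a p q)))
    (symᴾ (·-distribˡ a (b · q) (0# ∷ p *ᴾ q)))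

  0∷-*ᴾ : ∀ p q → (0# ∷ p) *ᴾ q ≈ᴾ 0# ∷ p *ᴾ q
  0∷-*ᴾ p q = +ᴾ-cong (0·p≈[] q) reflᴾ

  *ᴾ-assoc : ∀ p q r → (p *ᴾ q) *ᴾ r ≈ᴾ p *ᴾ (q *ᴾ r)
  *ᴾ-assoc []      q r = reflᴾ
  *ᴾ-assoc (a ∷ p) q r = transᴾ (*ᴾ-distribʳ r (a · q) (0# ∷ p *ᴾ q))
    (+ᴾ-cong (·-*ᴾ a q r) (transᴾ (0∷-*ᴾ (p *ᴾ q) r) (∷-cong refl (*ᴾ-assoc p q r))))

  *ᴾ-identityˡ : ∀ p → C 1# *ᴾ p ≈ᴾ p
  *ᴾ-identityˡ p = transᴾ (+ᴾ-cong (1·p≈p p) 0∷[]≈[]) (+ᴾ-identityʳ p)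

  *ᴾ-identityʳ : ∀ p → p *ᴾ C 1# ≈ᴾ p
  *ᴾ-identityʳ p = transᴾ (*ᴾ-comm p (C 1#)) (*ᴾ-identityˡ p)

  isCommutativeRingᴾ : IsCommutativeRing _≈ᴾ_ _+ᴾ_ _*ᴾ_ -ᴾ_ [] (C 1#)
  isCommutativeRingᴾ = record
    { isRing = record
      { +-isAbelianGroup = record
        { isGroup = record
          { isMonoid = IsCommutativeMonoid.isMonoid +ᴾ-isCommutativeMonoid
          ; inverse  = -ᴾ-inverseˡ , -ᴾ-inverseʳ
          ; ⁻¹-cong  = -ᴾ-cong }
        ; comm = +ᴾ-comm }
      ; *-cong     = *ᴾ-cong
      ; *-assoc    = *ᴾ-assoc
      ; *-identity = *ᴾ-identityˡ , *ᴾ-identityʳ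
      ; distrib    = *ᴾ-distribˡ , *ᴾ-distribʳ }
    ; *-comm = *ᴾ-comm }

  _#0ᴾ : Poly → Set ℓ₂
  p #0ᴾ = ∃[ k ] coeff p k #0

  private
    #0ᴾ-resp : ∀ {p q} → p ≈ᴾ q → p #0ᴾ → q #0ᴾ
    #0ᴾ-resp e (k , h) = k , #0-resp (at e k) h

    #0ᴾ-+ : ∀ p q → (p +ᴾ q) #0ᴾ → p #0ᴾ ⊎ q #0ᴾ
    #0ᴾ-+ p q (k , h) with #0-+ (#0-resp (coeff-+ p q k) h)
    ... | inj₁ h₁ = inj₁ (k , h₁)
    ... | inj₂ h₂ = inj₂ (k , h₂)

    #0ᴾ-*ˡ : ∀ p q → (p *ᴾ q) #0ᴾ → p #0ᴾ
    #0ᴾ-*ˡ []      q h = h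
    #0ᴾ-*ˡ (a ∷ p) q h with #0ᴾ-+ (a · q) (0# ∷ p *ᴾ q) h
    ... | inj₁ (k , h₁)     = 0 , #0-*ˡ (#0-resp (coeff-· a q k) h₁)
    ... | inj₂ (zero  , h₂) = contradiction h₂ 0-¬#0
    ... | inj₂ (suc k , h₂) with #0ᴾ-*ˡ p q (k , h₂)
    ...   | j , h₃ = suc j , h₃

    x#0⇒x+y#0⊎y#0 : ∀ {x y} → x #0 → x + y #0 ⊎ y #0
    x#0⇒x+y#0⊎y#0 {x} {y} h with #0-+ (#0-resp x≈ h)
      where
      x≈ : x ≈ (x + y) - y
      x≈ = sym (trans (+-assoc x y (- y)) (trans (+-congˡ (-‿inverseʳ y)) (+-identityʳ x)))
    ... | inj₁ s = inj₁ s
    ... | inj₂ n = inj₂ (#0-resp (RingProperties.-‿involutive ring y) (#0-neg n))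

    -- Used with a · r +ᴾ (0# ∷ s) = (a ∷ p) *ᴾ r, where s = p *ᴾ r.
    step : ∀ a r s → s #0ᴾ → (a · r +ᴾ (0# ∷ s)) #0ᴾ ⊎ a #0
    step a r s (k , h) with x#0⇒x+y#0⊎y#0 {y = coeff (a · r) (suc k)} h
    ... | inj₁ h₁ = inj₁ (suc k , #0-resp (trans (+-comm _ _) (sym (coeff-+ (a · r) (0# ∷ s) (suc k)))) h₁)
    ... | inj₂ h₂ = inj₂ (#0-*ˡ (#0-resp (coeff-· a r (suc k)) h₂))

    constants : ∀ a p b q → a #0 → b #0 → ((a ∷ p) *ᴾ (b ∷ q)) #0ᴾ
    constants a p b q ha hb = 0 , #0-resp (sym (+-identityʳ _)) (#0-* ha hb)

    constant-* : ∀ a p q → a #0 → q #0ᴾ → ((a ∷ p) *ᴾ q) #0ᴾ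
    constant-* a p []      ha (k , h) = contradiction h 0-¬#0
    constant-* a p (b ∷ q) ha (zero  , h) = constants a p b q ha h
    constant-* a p (b ∷ q) ha (suc k , h) with step b (a ∷ p) ((a ∷ p) *ᴾ q) (constant-* a p q ha (k , h))
    ... | inj₁ nz = #0ᴾ-resp (symᴾ (*ᴾ-∷ʳ (a ∷ p) b q)) nz
    ... | inj₂ hb = constants a p b q ha hb

    #0ᴾ-* : ∀ p q → p #0ᴾ → q #0ᴾ → (p *ᴾ q) #0ᴾ
    #0ᴾ-* []      q (k , h)     hq = contradiction h 0-¬#0
    #0ᴾ-* (a ∷ p) q (zero  , h) hq = constant-* a p q h hq
    #0ᴾ-* (a ∷ p) q (suc k , h) hq with step a q (p *ᴾ q) (#0ᴾ-* p q (k , h) hq)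
    ... | inj₁ nz = nz
    ... | inj₂ ha = constant-* a p q ha hq

  polynomialDomain : ApartnessDomain c ℓ₁ ℓ₂
  polynomialDomain = record
    { commutativeRing = record { isCommutativeRing = isCommutativeRingᴾ }
    ; _#0      = _#0ᴾ
    ; #0-resp  = #0ᴾ-resp
    ; #0-+     = λ {p} {q} → #0ᴾ-+ p q
    ; #0-*ˡ    = λ {p} {q} → #0ᴾ-*ˡ p q
    ; #0-*     = λ {p} {q} → #0ᴾ-* p q
    ; 1#0      = 0 , 1#0
    ; 0-¬#0    = λ (k , h) → 0-¬#0 h
    ; #0-tight = λ h → coeffwise λ k → #0-tight λ hk → h (k , hk)
    }

open Polynomial using (polynomialDomain)

-- D[X₀, …, X_{N-1}], as D[X_{N-1}]⋯[X₁][X₀].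
polynomials : ApartnessDomain c ℓ₁ ℓ₂ → ℕ → ApartnessDomain c ℓ₁ ℓ₂
polynomials D zero    = D
polynomials D (suc N) = polynomialDomain (polynomials D N)

module Polynomials (D : ApartnessDomain c ℓ₁ ℓ₂) where
  private
    module D = ApartnessDomain D
    module P (N : ℕ) = ApartnessDomain (polynomials D N)

  const : ∀ N → D.Carrier → P.Carrier N
  const zero    k = k
  const (suc N) k = Polynomial.C (polynomials D N) (const N k)

  var : ∀ N → Fin N → P.Carrier N
  var (suc N) zero    = Polynomial.X (polynomials D N)
  var (suc N) (suc i) = Polynomial.C (polynomials D N) (var N i)

  const-cong : ∀ N {k l} → k D.≈ l → P._≈_ N (const N k) (const N l)
  const-cong zero    e = e
  const-cong (suc N) e = Polynomial.∷-cong (polynomials D N) (const-cong N e) (P.refl (suc N))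

  const-0 : ∀ N → P._≈_ N (const N D.0#) (P.0# N)
  const-0 zero    = D.refl
  const-0 (suc N) = P.trans (suc N)
    (Polynomial.∷-cong (polynomials D N) (const-0 N) (P.refl (suc N)))
    (Polynomial.0∷[]≈[] (polynomials D N))

  const-1 : ∀ N → P._≈_ N (const N D.1#) (P.1# N)
  const-1 zero    = D.refl
  const-1 (suc N) = Polynomial.∷-cong (polynomials D N) (const-1 N) (P.refl (suc N))

  const-+ : ∀ N k l → P._≈_ N (const N (k D.+ l)) (P._+_ N (const N k) (const N l))
  const-+ zero    k l = D.refl
  const-+ (suc N) k l = Polynomial.∷-cong (polynomials D N) (const-+ N k l) (P.refl (suc N))

  const-neg : ∀ N k → P._≈_ N (const N (D.- k)) (P.-_ N (const N k))
  const-neg zero    k = D.refl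
  const-neg (suc N) k = Polynomial.∷-cong (polynomials D N) (const-neg N k) (P.refl (suc N))

  linear : ∀ N → Fin N → Fin N → D.Carrier → P.Carrier N
  linear N i j k = (var N i - var N j) + const N k
    where open P N

  linear#0 : ∀ N i j k → i ≢ j → P._#0 N (linear N i j k)
  linear#0 (suc N) zero    zero    k i≢j = contradiction ≡.refl i≢j
  linear#0 (suc N) zero    (suc j) k i≢j = 1 , P.1#0 N
  linear#0 (suc N) (suc i) zero    k i≢j = 1 , DomainProperties.#0-neg (polynomials D N) (P.1#0 N)
  linear#0 (suc N) (suc i) (suc j) k i≢j = 0 , linear#0 N i j k (i≢j ∘′ ≡.cong suc)

module Fractions (D : ApartnessDomain c ℓ₁ ℓ₂) where
  open ApartnessDomain D
  open DomainProperties D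
  open RingProperties ring
  open ≈-Reasoning setoid
  open SemiringSolver commutativeSemiring using (solve; _:=_; _:+_; _:*_; con)

  record Fraction : Set (c ⊔ ℓ₂) where
    constructor fraction
    field
      num    : Carrier
      den    : Carrier
      den-#0 : den #0
  open Fraction public

  infix  4 _≈ᶠ_ _#ᶠ_
  infixl 6 _+ᶠ_
  infixl 7 _*ᶠ_

  record _≈ᶠ_ (x y : Fraction) : Set ℓ₁ where
    constructor cross
    field eq : num x * den y ≈ num y * den x

  _+ᶠ_ _*ᶠ_ : Fraction → Fraction → Fraction
  fraction n d h +ᶠ fraction n′ d′ h′ = fraction (n * d′ + n′ * d) (d * d′) (#0-* h h′)
  fraction n d h *ᶠ fraction n′ d′ h′ = fraction (n * n′) (d * d′) (#0-* h h′)

  -ᶠ_ : Fraction → Fraction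
  -ᶠ fraction n d h = fraction (- n) d h

  frac : Carrier → Fraction
  frac x = fraction x 1# 1#0

  _#ᶠ_ : Fraction → Fraction → Set ℓ₂
  x #ᶠ y = num (x +ᶠ (-ᶠ y)) #0

  private
    ≈ᶠ-trans : ∀ {x y z} → x ≈ᶠ y → y ≈ᶠ z → x ≈ᶠ z
    ≈ᶠ-trans {fraction a b _} {fraction a′ b′ h} {fraction a″ b″ _} (cross e) (cross f) = cross (*-cancelʳ h (begin
      a * b″ * b′     ≈⟨ solve 3 (λ a b″ b′ → a :* b″ :* b′ := a :* b′ :* b″) refl a b″ b′ ⟩
      a * b′ * b″     ≈⟨ *-congʳ e ⟩
      a′ * b * b″     ≈⟨ solve 3 (λ a′ b b″ → a′ :* b :* b″ := a′ :* b″ :* b) refl a′ b b″ ⟩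
      a′ * b″ * b     ≈⟨ *-congʳ f ⟩
      a″ * b′ * b     ≈⟨ solve 3 (λ a″ b′ b → a″ :* b′ :* b := a″ :* b :* b′) refl a″ b′ b ⟩
      a″ * b * b′     ∎))

    ≈ᶠ-isEquivalence : IsEquivalence _≈ᶠ_
    ≈ᶠ-isEquivalence = record
      { refl  = cross refl
      ; sym   = λ (cross e) → cross (sym e)
      ; trans = ≈ᶠ-trans
      }

    open IsEquivalence ≈ᶠ-isEquivalence using () renaming (refl to reflᶠ; sym to symᶠ)

    +ᶠ-cong : ∀ {x x′ y y′} → x ≈ᶠ x′ → y ≈ᶠ y′ → x +ᶠ y ≈ᶠ x′ +ᶠ y′
    +ᶠ-cong {fraction a b _} {fraction a′ b′ _} {fraction p q _} {fraction p′ q′ _} (cross e) (cross f) = cross (begin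
      (a * q + p * b) * (b′ * q′)
        ≈⟨ solve 6 (λ a b p q b′ q′ → (a :* q :+ p :* b) :* (b′ :* q′) := (a :* b′) :* (q :* q′) :+ (p :* q′) :* (b :* b′)) refl a b p q b′ q′ ⟩
      (a * b′) * (q * q′) + (p * q′) * (b * b′)
        ≈⟨ +-cong (*-congʳ e) (*-congʳ f) ⟩
      (a′ * b) * (q * q′) + (p′ * q) * (b * b′)
        ≈⟨ solve 6 (λ a′ b p′ q b′ q′ → (a′ :* b) :* (q :* q′) :+ (p′ :* q) :* (b :* b′) := (a′ :* q′ :+ p′ :* b′) :* (b :* q)) refl a′ b p′ q b′ q′ ⟩
      (a′ * q′ + p′ * b′) * (b * q) ∎)

    *ᶠ-cong : ∀ {x x′ y y′} → x ≈ᶠ x′ → y ≈ᶠ y′ → x *ᶠ y ≈ᶠ x′ *ᶠ y′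
    *ᶠ-cong {fraction a b _} {fraction a′ b′ _} {fraction p q _} {fraction p′ q′ _} (cross e) (cross f) = cross (begin
      (a * p) * (b′ * q′)    ≈⟨ solve 4 (λ a p b′ q′ → (a :* p) :* (b′ :* q′) := (a :* b′) :* (p :* q′)) refl a p b′ q′ ⟩
      (a * b′) * (p * q′)    ≈⟨ *-cong e f ⟩
      (a′ * b) * (p′ * q)    ≈⟨ solve 4 (λ a p b′ q′ → (a :* b′) :* (p :* q′) := (a :* p) :* (b′ :* q′)) refl a′ p′ b q ⟩
      (a′ * p′) * (b * q)    ∎)

    -ᶠ-cong : ∀ {x y} → x ≈ᶠ y → -ᶠ x ≈ᶠ -ᶠ y
    -ᶠ-cong {fraction a b _} {fraction a′ b′ _} (cross e) = cross (begin
      - a * b′      ≈⟨ -‿distribˡ-* a b′ ⟨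
      - (a * b′)    ≈⟨ -‿cong e ⟩
      - (a′ * b)    ≈⟨ -‿distribˡ-* a′ b ⟩
      - a′ * b      ∎)

    +ᶠ-assoc : ∀ x y z → (x +ᶠ y) +ᶠ z ≈ᶠ x +ᶠ (y +ᶠ z)
    +ᶠ-assoc (fraction a b _) (fraction p q _) (fraction u v _) = cross
      (solve 6 (λ a b p q u v →
        ((a :* q :+ p :* b) :* v :+ u :* (b :* q)) :* (b :* (q :* v)) :=
        (a :* (q :* v) :+ (p :* v :+ u :* q) :* b) :* (b :* q :* v)) refl a b p q u v)

    +ᶠ-comm : ∀ x y → x +ᶠ y ≈ᶠ y +ᶠ x
    +ᶠ-comm (fraction a b _) (fraction p q _) = cross
      (solve 4 (λ a b p q → (a :* q :+ p :* b) :* (q :* b) := (p :* b :+ a :* q) :* (b :* q)) refl a b p q)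

    +ᶠ-identityˡ : ∀ x → frac 0# +ᶠ x ≈ᶠ x
    +ᶠ-identityˡ (fraction a b _) = cross
      (solve 2 (λ a b → (con 0 :* b :+ a :* con 1) :* b := a :* (con 1 :* b)) refl a b)

    +ᶠ-identityʳ : ∀ x → x +ᶠ frac 0# ≈ᶠ x
    +ᶠ-identityʳ (fraction a b _) = cross
      (solve 2 (λ a b → (a :* con 1 :+ con 0 :* b) :* b := a :* (b :* con 1)) refl a b)

    numerator : ∀ a b p q → a * q + - p * b ≈ a * q - p * b
    numerator a b p q = +-congˡ (sym (-‿distribˡ-* p b))

    vanishing : ∀ {u v w} → u ≈ 0# → u * v ≈ 0# * w
    vanishing e = trans (*-congʳ e) (trans (zeroˡ _) (sym (zeroˡ _)))

    -ᶠ-inverseʳ : ∀ x → x +ᶠ (-ᶠ x) ≈ᶠ frac 0#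
    -ᶠ-inverseʳ (fraction a b _) = cross (vanishing (trans (numerator a b a b) (-‿inverseʳ (a * b))))

    -ᶠ-inverseˡ : ∀ x → (-ᶠ x) +ᶠ x ≈ᶠ frac 0#
    -ᶠ-inverseˡ x = ≈ᶠ-trans (+ᶠ-comm (-ᶠ x) x) (-ᶠ-inverseʳ x)

    *ᶠ-assoc : ∀ x y z → (x *ᶠ y) *ᶠ z ≈ᶠ x *ᶠ (y *ᶠ z)
    *ᶠ-assoc (fraction a b _) (fraction p q _) (fraction u v _) = cross
      (solve 6 (λ a b p q u v → a :* p :* u :* (b :* (q :* v)) := a :* (p :* u) :* (b :* q :* v)) refl a b p q u v)

    *ᶠ-comm : ∀ x y → x *ᶠ y ≈ᶠ y *ᶠ x
    *ᶠ-comm (fraction a b _) (fraction p q _) = cross (*-cong (*-comm a p) (*-comm q b))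

    *ᶠ-identityˡ : ∀ x → frac 1# *ᶠ x ≈ᶠ x
    *ᶠ-identityˡ (fraction a b _) = cross
      (solve 2 (λ a b → con 1 :* a :* b := a :* (con 1 :* b)) refl a b)

    *ᶠ-distribʳ : ∀ z x y → (x +ᶠ y) *ᶠ z ≈ᶠ x *ᶠ z +ᶠ y *ᶠ z
    *ᶠ-distribʳ (fraction u v _) (fraction a b _) (fraction p q _) = cross
      (solve 6 (λ a b p q u v →
        (a :* q :+ p :* b) :* u :* (b :* v :* (q :* v)) :=
        (a :* u :* (q :* v) :+ p :* u :* (b :* v)) :* (b :* q :* v)) refl a b p q u v)

    *ᶠ-distribˡ : ∀ z x y → z *ᶠ (x +ᶠ y) ≈ᶠ z *ᶠ x +ᶠ z *ᶠ y
    *ᶠ-distribˡ z x y = ≈ᶠ-trans (*ᶠ-comm z (x +ᶠ y))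
      (≈ᶠ-trans (*ᶠ-distribʳ z x y) (+ᶠ-cong (*ᶠ-comm x z) (*ᶠ-comm y z)))

    isCommutativeRingᶠ : IsCommutativeRing _≈ᶠ_ _+ᶠ_ _*ᶠ_ -ᶠ_ (frac 0#) (frac 1#)
    isCommutativeRingᶠ = record
      { isRing = record
        { +-isAbelianGroup = record
          { isGroup = record
            { isMonoid = record
              { isSemigroup = record
                { isMagma = record { isEquivalence = ≈ᶠ-isEquivalence ; ∙-cong = +ᶠ-cong }
                ; assoc = +ᶠ-assoc }
              ; identity = +ᶠ-identityˡ , +ᶠ-identityʳ }
            ; inverse = -ᶠ-inverseˡ , -ᶠ-inverseʳ
            ; ⁻¹-cong = -ᶠ-cong }
          ; comm = +ᶠ-comm }
        ; *-cong     = *ᶠ-cong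
        ; *-assoc    = *ᶠ-assoc
        ; *-identity = *ᶠ-identityˡ , λ x → ≈ᶠ-trans (*ᶠ-comm x (frac 1#)) (*ᶠ-identityˡ x)
        ; distrib    = *ᶠ-distribˡ , *ᶠ-distribʳ }
      ; *-comm = *ᶠ-comm }

    #ᶠ-irrefl : ∀ {x y} → x ≈ᶠ y → ¬ x #ᶠ y
    #ᶠ-irrefl {fraction a b _} {fraction p q _} (cross e) h =
      0-¬#0 (#0-resp (trans (numerator a b p q) (trans (+-congʳ e) (-‿inverseʳ (p * b)))) h)

    #ᶠ-sym : ∀ {x y} → x #ᶠ y → y #ᶠ x
    #ᶠ-sym {fraction a b _} {fraction p q _} h = #0-resp (begin
      - (a * q + - p * b)    ≈⟨ -‿cong (numerator a b p q) ⟩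
      - (a * q - p * b)      ≈⟨ ⁻¹-anti-homo‿- (a * q) (p * b) ⟩
      p * b - a * q          ≈⟨ numerator p q a b ⟨
      p * b + - a * q        ∎) (#0-neg h)

    #ᶠ-cotrans : ∀ {x y} → x #ᶠ y → ∀ z → x #ᶠ z ⊎ z #ᶠ y
    #ᶠ-cotrans {fraction a b hb} {fraction p q hq} h (fraction u v hv)
      with #0-+ (#0-resp split (#0-* h hv))
      where
      split : (a * q + - p * b) * v ≈ (a * v + - u * b) * q + (u * q + - p * v) * b
      split = begin
        (a * q + - p * b) * v
          ≈⟨ +-identityʳ _ ⟨
        (a * q + - p * b) * v + 0#
          ≈⟨ +-congˡ (trans (*-congʳ (-‿inverseˡ u)) (zeroˡ (b * q))) ⟨
        (a * q + - p * b) * v + (- u + u) * (b * q)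
          ≈⟨ solve 7 (λ a b p′ q u u′ v →
               (a :* q :+ p′ :* b) :* v :+ (u′ :+ u) :* (b :* q) :=
               (a :* v :+ u′ :* b) :* q :+ (u :* q :+ p′ :* v) :* b) refl a b (- p) q u (- u) v ⟩
        (a * v + - u * b) * q + (u * q + - p * v) * b ∎
    ... | inj₁ h₁ = inj₁ (#0-*ˡ h₁)
    ... | inj₂ h₂ = inj₂ (#0-*ˡ h₂)

    #ᶠ-tight : ∀ {x y} → ¬ x #ᶠ y → x ≈ᶠ y
    #ᶠ-tight {fraction a b _} {fraction p q _} h =
      cross (x-y≈0⇒x≈y (trans (sym (numerator a b p q)) (#0-tight h)))

  open import Algebra.Definitions _≈ᶠ_ using (Invertible)

  private
    #0⇒invertible : ∀ w → num w #0 → Invertible (frac 1#) _*ᶠ_ w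
    #0⇒invertible w@(fraction a b h) h′ = w⁻¹ , inverseˡ , ≈ᶠ-trans (*ᶠ-comm w w⁻¹) inverseˡ
      where
      w⁻¹ : Fraction
      w⁻¹ = fraction b a h′
      inverseˡ : w⁻¹ *ᶠ w ≈ᶠ frac 1#
      inverseˡ = cross (solve 2 (λ a b → b :* a :* con 1 := con 1 :* (a :* b)) refl a b)

    invertible⇒#0 : ∀ w → Invertible (frac 1#) _*ᶠ_ w → num w #0
    invertible⇒#0 (fraction a b h) (fraction i j h′ , cross e , _) =
      #0-*ʳ (#0-*ˡ (#0-resp (sym e) (#0-* 1#0 (#0-* h′ h))))

  fractionField : HeytingField (c ⊔ ℓ₂) ℓ₁ ℓ₂
  fractionField = record
    { Carrier = Fraction
    ; _≈_     = _≈ᶠ_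
    ; _#_     = _#ᶠ_
    ; _+_     = _+ᶠ_
    ; _*_     = _*ᶠ_
    ; -_      = -ᶠ_
    ; 0#      = frac 0#
    ; 1#      = frac 1#
    ; isHeytingField = record
      { isHeytingCommutativeRing = record
        { isCommutativeRing   = isCommutativeRingᶠ
        ; isApartnessRelation = record { irrefl = #ᶠ-irrefl ; sym = λ {x} {y} → #ᶠ-sym {x} {y} ; cotrans = λ {x} {y} → #ᶠ-cotrans {x} {y} }
        ; #⇒invertible = λ {x} {y} → #0⇒invertible (x +ᶠ (-ᶠ y))
        ; invertible⇒# = λ {x} {y} → invertible⇒#0 (x +ᶠ (-ᶠ y))
        }
      ; tight = λ x y → #ᶠ-tight {x} {y} , #ᶠ-irrefl
      }
    }

  frac-cong : ∀ {u v} → u ≈ v → frac u ≈ᶠ frac v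
  frac-cong e = cross (*-congʳ e)

  frac-+ : ∀ u v → frac (u + v) ≈ᶠ frac u +ᶠ frac v
  frac-+ u v = cross (solve 2 (λ u v →
    (u :+ v) :* (con 1 :* con 1) := (u :* con 1 :+ v :* con 1) :* con 1) refl u v)

  frac-#0 : ∀ {u} → u #0 → frac u #ᶠ frac 0#
  frac-#0 {u} h = #0-resp (begin
    u                     ≈⟨ solve 1 (λ u → u := u :* con 1 :+ con 0 :* con 1) refl u ⟩
    u * 1# + 0# * 1#      ≈⟨ +-congˡ (*-congʳ (sym -0#≈0#)) ⟩
    u * 1# + - 0# * 1#    ∎) h

module PrimeSubfield (K : HeytingField c ℓ₁ ℓ₂) where
  open HeytingField K
  open HeytingCommutativeRing heytingCommutativeRing using (commutativeRing)
  open CommutativeRing commutativeRing using (ring; semiring)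
  open RingProperties ring using (+-inverseˡ-unique)
  open HeytingProperties heytingCommutativeRing using (x#0y#0→xy#0)
  open Multiples semiring using (×-homo-+; ×1-homo-*; ×-congˡ) renaming (_×_ to _ℕ×_) public
  open ≈-Reasoning setoid

  HasCharacteristic : ℕ → Set ℓ₁
  HasCharacteristic p = ∀ k → (k ℕ× 1# ≈ 0#) ⇔ (p ∣ k)

  -- The additive subgroup generated by 1#; in positive characteristic the
  -- natural multiples of 1# are all of it, and it is the prime subfield.
  InPrimeSubfield : Carrier → Set ℓ₁
  InPrimeSubfield x = ∃[ k ] x ≈ k ℕ× 1#

  module _ {p : ℕ} (char : HasCharacteristic p) where

    private
      p×1≈0 : p ℕ× 1# ≈ 0#
      p×1≈0 = Equivalence.from (char p) ∣.∣-refl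

      multiple≈0 : ∀ q → (q ℕ.* p) ℕ× 1# ≈ 0#
      multiple≈0 q = Equivalence.from (char (q ℕ.* p)) (divides q ≡.refl)

    -2∈ : 2 ℕ.< p → InPrimeSubfield (- (1# + 1#))
    -2∈ (s≤s (s≤s (s≤s {n = m} z≤n))) = suc m , sym (+-inverseˡ-unique _ _ (begin
      suc m ℕ× 1# + (1# + 1#)      ≈⟨ +-comm _ _ ⟩
      (1# + 1#) + suc m ℕ× 1#      ≈⟨ +-assoc _ _ _ ⟩
      1# + (1# + suc m ℕ× 1#)      ≈⟨ p×1≈0 ⟩
      0#                           ∎))

    module _ (p>0 : 0 ℕ.< p) {a : Carrier} (a∈ : InPrimeSubfield a) (a#0 : a # 0#) where

      private
        α : ℕ
        α = proj₁ a∈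

        instance
          p≢0 : ℕ.NonZero p
          p≢0 = ℕ.>-nonZero p>0

        cancel : ∀ {y} → a * y ≈ 0# → y ≈ 0#
        cancel {y} ay≈0 = proj₁ (tight y 0#) λ y#0 → #-irrefl ay≈0 (x#0y#0→xy#0 a#0 y#0)

        gcd≡1 : gcd α p ≡ 1
        gcd≡1 with gcd[m,n]∣m α p | gcd[m,n]∣n α p
        ... | divides f eqα | divides e eqp = ℕ.*-cancelˡ-≡ (gcd α p) 1 p
          (≡.trans (≡.cong (ℕ._* gcd α p) (≡.sym e≡p)) (≡.trans (≡.sym eqp) (≡.sym (ℕ.*-identityʳ p))))
          where
          αe≡fp : α ℕ.* e ≡ f ℕ.* p
          αe≡fp = ≡.trans (≡.cong (ℕ._* e) eqα) (≡.trans (ℕ.*-assoc f (gcd α p) e)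
            (≡.cong (f ℕ.*_) (≡.trans (ℕ.*-comm (gcd α p) e) (≡.sym eqp))))
          e×1≈0 : e ℕ× 1# ≈ 0#
          e×1≈0 = cancel (begin
            a * (e ℕ× 1#)              ≈⟨ *-congʳ (proj₂ a∈) ⟩
            (α ℕ× 1#) * (e ℕ× 1#)      ≈⟨ ×1-homo-* α e ⟨
            (α ℕ.* e) ℕ× 1#            ≈⟨ ×-congˡ αe≡fp ⟩
            (f ℕ.* p) ℕ× 1#            ≈⟨ multiple≈0 f ⟩
            0#                         ∎)
          e≡p : e ≡ p
          e≡p = ∣.∣-antisym (divides (gcd α p) (≡.trans eqp (ℕ.*-comm e (gcd α p)))) (Equivalence.to (char e) e×1≈0)

        inverse : ∃[ u ] a * (u ℕ× 1#) ≈ 1#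
        inverse with ≡.subst (λ g → Bézout.Identity.Identity g α p) gcd≡1 (Bézout.identity (gcd-GCD α p))
        ... | Bézout.Identity.+- x y eq = x , (begin
          a * (x ℕ× 1#)               ≈⟨ *-congʳ (proj₂ a∈) ⟩
          (α ℕ× 1#) * (x ℕ× 1#)       ≈⟨ ×1-homo-* α x ⟨
          (α ℕ.* x) ℕ× 1#             ≈⟨ ×-congˡ (≡.trans (ℕ.*-comm α x) (≡.sym eq)) ⟩
          1# + (y ℕ.* p) ℕ× 1#        ≈⟨ +-congˡ (multiple≈0 y) ⟩
          1# + 0#                     ≈⟨ +-identityʳ 1# ⟩
          1#                          ∎)
        -- here a * x = -1, so the inverse is x * (a * x)
        ... | Bézout.Identity.-+ x y eq = (x ℕ.* (α ℕ.* x)) , (begin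
          a * ((x ℕ.* (α ℕ.* x)) ℕ× 1#)                        ≈⟨ *-congʳ (proj₂ a∈) ⟩
          (α ℕ× 1#) * ((x ℕ.* (α ℕ.* x)) ℕ× 1#)                ≈⟨ ×1-homo-* α (x ℕ.* (α ℕ.* x)) ⟨
          (α ℕ.* (x ℕ.* (α ℕ.* x))) ℕ× 1#                      ≈⟨ ×-congˡ (≡.sym (ℕ.*-assoc α x (α ℕ.* x))) ⟩
          ((α ℕ.* x) ℕ.* (α ℕ.* x)) ℕ× 1#                      ≈⟨ ×1-homo-* (α ℕ.* x) (α ℕ.* x) ⟩
          ((α ℕ.* x) ℕ× 1#) * ((α ℕ.* x) ℕ× 1#)                ≈⟨ *-cong αx≈-1 αx≈-1 ⟩
          - 1# * - 1#                                          ≈⟨ RingProperties.-1*x≈-x ring (- 1#) ⟩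
          - (- 1#)                                             ≈⟨ RingProperties.-‿involutive ring 1# ⟩
          1#                                                   ∎)
          where
          αx≈-1 : (α ℕ.* x) ℕ× 1# ≈ - 1#
          αx≈-1 = +-inverseˡ-unique _ _ (begin
            (α ℕ.* x) ℕ× 1# + 1#      ≈⟨ +-comm _ _ ⟩
            1# + (α ℕ.* x) ℕ× 1#      ≈⟨ ×-congˡ {1#} (≡.trans (≡.cong suc (ℕ.*-comm α x)) eq) ⟩
            (y ℕ.* p) ℕ× 1#           ≈⟨ multiple≈0 y ⟩
            0#                        ∎)

      -- The number b̄, which is determined by this specification since
      -- k ↦ a * (k ℕ× 1#) is injective on {1, …, p}.
      quotient : ∀ {b} → InPrimeSubfield b → ∃[ k ] 1 ℕ.≤ k × k ℕ.≤ p × a * (k ℕ× 1#) ≈ b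
      quotient {b} (β , b≈) = suc (i % p) , s≤s z≤n , m%n<n i p , (begin
        a * (suc (i % p) ℕ× 1#)                              ≈⟨ *-congˡ (+-identityʳ _) ⟨
        a * (suc (i % p) ℕ× 1# + 0#)                         ≈⟨ *-congˡ (+-congˡ (multiple≈0 (i ℕ./ p))) ⟨
        a * (suc (i % p) ℕ× 1# + (i ℕ./ p ℕ.* p) ℕ× 1#)      ≈⟨ *-congˡ (×-homo-+ 1# (suc (i % p)) (i ℕ./ p ℕ.* p)) ⟨
        a * ((suc (i % p) ℕ.+ i ℕ./ p ℕ.* p) ℕ× 1#)          ≈⟨ *-congˡ (×-congˡ (≡.cong suc (≡.sym (m≡m%n+[m/n]*n i p)))) ⟩
        a * (suc i ℕ× 1#)                                    ≈⟨ *-congˡ (×-congˡ 1+i≡uβ+p) ⟩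
        a * ((u ℕ.* β ℕ.+ p) ℕ× 1#)                          ≈⟨ *-congˡ (×-homo-+ 1# (u ℕ.* β) p) ⟩
        a * ((u ℕ.* β) ℕ× 1# + p ℕ× 1#)                      ≈⟨ *-congˡ (+-congˡ p×1≈0) ⟩
        a * ((u ℕ.* β) ℕ× 1# + 0#)                           ≈⟨ *-congˡ (+-identityʳ _) ⟩
        a * ((u ℕ.* β) ℕ× 1#)                                ≈⟨ *-congˡ (×1-homo-* u β) ⟩
        a * ((u ℕ× 1#) * (β ℕ× 1#))                          ≈⟨ *-assoc _ _ _ ⟨
        a * (u ℕ× 1#) * (β ℕ× 1#)                            ≈⟨ *-cong (proj₂ inverse) (sym b≈) ⟩
        1# * b                                               ≈⟨ *-identityˡ b ⟩
        b                                                    ∎)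
        where
        u i : ℕ
        u = proj₁ inverse
        i = u ℕ.* β ℕ.+ ℕ.pred p
        1+i≡uβ+p : suc i ≡ u ℕ.* β ℕ.+ p
        1+i≡uβ+p = ≡.trans (≡.sym (ℕ.+-suc (u ℕ.* β) (ℕ.pred p))) (≡.cong (u ℕ.* β ℕ.+_) (ℕ.suc-pred p))

module FieldOperations (K : HeytingField c ℓ₁ ℓ₂) where
  open HeytingField K
  open HeytingCommutativeRing heytingCommutativeRing using (commutativeRing)
  open CommutativeRing commutativeRing using (semiring)

  infixl 7 _/_[_]
  _/_[_] : Carrier → (y : Carrier) → y # 0# → Carrier
  x / y [ y#0 ] = x * proj₁ (#⇒invertible y#0)

  ∏ : ∀ {k} → Vector Carrier k → Carrier
  ∏ = RawSemiring.product (Semiring.rawSemiring semiring)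

  factor : ∀ {ℓ} {A : Set ℓ} → Dec A → (A → Carrier) → Carrier
  factor (yes h) f = f h
  factor (no _)  f = 1#

  -- ∏-where P? f is the product of f j over those j which satisfy P.
  ∏-where : ∀ {k ℓ} {P : Fin k → Set ℓ} → (∀ j → Dec (P j)) → (∀ j → P j → Carrier) → Carrier
  ∏-where P? f = ∏ λ j → factor (P? j) (f j)

-- Everything here is for κ = 1; in particular the -2 in F is -2κ, and the
-- connection lives over K(s,x), where s, x are the coordinate functions.
module MasterFunction
  (K : HeytingField c ℓ₁ ℓ₂)
  (p : ℕ) (char : PrimeSubfield.HasCharacteristic K p) (p>2 : 2 ℕ.< p)
  (n r : ℕ)
  (Λ : Fin n → HeytingField.Carrier K) (Λ∈ : ∀ m → PrimeSubfield.InPrimeSubfield K (Λ m))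
  (a : HeytingField.Carrier K) (a∈ : PrimeSubfield.InPrimeSubfield K a)
  (a#0 : HeytingField._#_ K a (HeytingField.0# K))
  where

  private
    module K = HeytingField K
    open PrimeSubfield K

  N : ℕ
  N = r ℕ.+ n

  K[s,x] : ApartnessDomain c ℓ₁ ℓ₂
  K[s,x] = polynomials (fieldDomain K) N

  private
    open Polynomials (fieldDomain K)
    open Fractions K[s,x] using (frac; frac-cong; frac-+; frac-#0)
    module P = ApartnessDomain K[s,x]

  K⟨s,x⟩ : HeytingField (c ⊔ ℓ₂) ℓ₁ ℓ₂
  K⟨s,x⟩ = Fractions.fractionField K[s,x]

  open HeytingField K⟨s,x⟩
  open FieldOperations K⟨s,x⟩
  private
    open HeytingProperties heytingCommutativeRing using (#-congʳ; x#0y#0→xy#0)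
    open ≈-Reasoning setoid

  ι : K.Carrier → Carrier
  ι k = frac (const N k)

  s : Fin r → Carrier
  s l = frac (var N (l ↑ˡ n))

  x : Fin n → Carrier
  x m = frac (var N (r ↑ʳ m))

  IsPolynomial : Carrier → Set (c ⊔ ℓ₁)
  IsPolynomial f = ∃[ P ] f ≈ frac P

  bar : ∀ {b} → InPrimeSubfield b → ℕ
  bar b∈ = proj₁ (quotient {p} char (ℕ.<-trans (s≤s z≤n) p>2) a∈ a#0 b∈)

  g : Carrier → (b : K.Carrier) → InPrimeSubfield b → Carrier
  g y b b∈ = ∏ {ℕ.pred (bar b∈)} λ i → y + ι (suc (toℕ i) ℕ× a)

  -- F as a function on K⟨s,x⟩ʳ × K⟨s,x⟩ⁿ; its value at (s , x) is the
  -- rational function F(s,x).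
  F : (Fin r → Carrier) → (Fin n → Carrier) → Carrier
  F σ ξ = ∏ (λ m → ∏ λ l → g (σ l - ξ m) (Λ m) (Λ∈ m))
        * ∏ (λ l → ∏-where (Fin._<? l) λ j _ →
            (σ l - σ j) * g (σ l - σ j + 1#) (K.- (K.1# K.+ K.1#)) (-2∈ {p} char p>2))

  _+a[_] : ∀ {k} → (Fin k → Carrier) → Fin k → Fin k → Carrier
  v +a[ i ] = updateAt v i (_+ ι a)

  s≢x : ∀ l m → l ↑ˡ n ≢ r ↑ʳ m
  s≢x l m eq with ≡.trans (≡.sym (splitAt-↑ˡ r l n)) (≡.trans (≡.cong (splitAt r) eq) (splitAt-↑ʳ r n m))
  ... | ()

  s≢s : ∀ {l j : Fin r} → j ≢ l → l ↑ˡ n ≢ j ↑ˡ n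
  s≢s {l} {j} j≢l eq = j≢l (≡.sym (↑ˡ-injective n l j eq))

  #0-cong : ∀ {u v} → u ≈ v → u # 0# → v # 0#
  #0-cong = #-congʳ {z = 0#}

  linear# : ∀ i j k → i ≢ j → (frac (var N i) - frac (var N j)) + ι k # 0#
  linear# i j k i≢j = #0-cong
    (trans (frac-+ (var N i P.- var N j) (const N k)) (+-congʳ (frac-+ (var N i) (P.- var N j))))
    (frac-#0 (linear#0 N i j k i≢j))

  ι-+ : ∀ k k′ → ι (k K.+ k′) ≈ ι k + ι k′
  ι-+ k k′ = trans (frac-cong (const-+ N k k′)) (frac-+ (const N k) (const N k′))

  s-x+a#0 : ∀ l m → s l - x m + ι a # 0#
  s-x+a#0 l m = linear# (l ↑ˡ n) (r ↑ʳ m) a (s≢x l m)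

  s-x+Λ-a#0 : ∀ l m → s l - x m + ι (Λ m) - ι a # 0#
  s-x+Λ-a#0 l m = #0-cong (begin
    s l - x m + ι (Λ m K.- a)            ≈⟨ +-congˡ (ι-+ (Λ m) (K.- a)) ⟩
    s l - x m + (ι (Λ m) + ι (K.- a))    ≈⟨ +-congˡ (+-congˡ (frac-cong (const-neg N a))) ⟩
    s l - x m + (ι (Λ m) - ι a)          ≈⟨ +-assoc (s l - x m) (ι (Λ m)) (- ι a) ⟨
    s l - x m + ι (Λ m) - ι a            ∎)
    (linear# (l ↑ˡ n) (r ↑ʳ m) (Λ m K.- a) (s≢x l m))

  s-s#0 : ∀ {l j} → j ≢ l → s l - s j # 0#
  s-s#0 {l} {j} j≢l = #0-cong (begin
    s l - s j + ι K.0#    ≈⟨ +-congˡ (frac-cong (const-0 N)) ⟩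
    s l - s j + 0#        ≈⟨ +-identityʳ (s l - s j) ⟩
    s l - s j             ∎)
    (linear# (l ↑ˡ n) (j ↑ˡ n) K.0# (s≢s j≢l))

  s-s+1+a#0 : ∀ {l j} → j ≢ l → s l - s j + 1# + ι a # 0#
  s-s+1+a#0 {l} {j} j≢l = #0-cong (begin
    s l - s j + ι (K.1# K.+ a)      ≈⟨ +-congˡ (ι-+ K.1# a) ⟩
    s l - s j + (ι K.1# + ι a)      ≈⟨ +-congˡ (+-congʳ (frac-cong (const-1 N))) ⟩
    s l - s j + (1# + ι a)          ≈⟨ +-assoc (s l - s j) 1# (ι a) ⟨
    s l - s j + 1# + ι a            ∎)
    (linear# (l ↑ˡ n) (j ↑ˡ n) (K.1# K.+ a) (s≢s j≢l))

  Φ-denominator#0 : ∀ {l j} → j ≢ l → (s l - s j) * (s l - s j + 1# + ι a) # 0#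
  Φ-denominator#0 {l} {j} j≢l =
    x#0y#0→xy#0 {s l - s j} {s l - s j + 1# + ι a} (s-s#0 j≢l) (s-s+1+a#0 j≢l)

  Φ : Fin r → Carrier
  Φ l = ∏ (λ i → (s l - x i + ι (Λ i)) / (s l - x i + ι a) [ s-x+a#0 l i ])
      * ∏-where (λ j → ¬? (j Fin.≟ l)) λ j j≢l →
          ((s l - s j + ι a) * (s l - s j - 1#))
          / ((s l - s j) * (s l - s j + 1# + ι a)) [ Φ-denominator#0 j≢l ]

  Ψ : Fin n → Carrier
  Ψ m = ∏ λ j → (s j - x m) / (s j - x m + ι (Λ m) - ι a) [ s-x+Λ-a#0 j m ]

{-# OPTIONS --safe #-}
module Submission where

-- With b = k a, the product g(y, b) = (y + a) ⋯ (y + (k − 1) a) telescopes: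
-- g(y + a, b) (y + a) = g(y, b) (y + b).  Hence h(y) = y g(y + 1, −2) satisfies
-- h(y + a) / h(y) = R(y) := (y + a)(y − 1) / (y (y + 1 + a)).  Moreover
-- R(y) R(− y − a) = 1, so h(y − a) / h(y) = R(− y): the factor of Φ_l attached to
-- j ≠ l has the same form whether F contains s_l − s_j or s_j − s_l.

open import Defs
open import Algebra.Apartness.Bundles using (HeytingCommutativeRing; HeytingField)
open import Algebra.Bundles using (CommutativeRing)
open import Data.Fin.Base as Fin using (Fin; zero; suc; toℕ; _↑ˡ_; _↑ʳ_)
open import Data.Fin.Properties as Fin using (<-cmp; <⇒≢)
open import Data.Nat.Base as ℕ using (ℕ; zero; suc; _≤_; _<_)
import Data.Nat.Properties as ℕ
open import Data.Product.Base using (_×_; Σ-syntax; _,_; proj₁; proj₂)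
open import Data.Vec.Functional using (Vector; updateAt)
open import Data.Vec.Functional.Properties using (updateAt-updates; updateAt-minimal)
open import Function.Base using (_∘′_)
open import Level using (Level; _⊔_)
open import Relation.Binary.Definitions using (tri<; tri≈; tri>)
open import Relation.Binary.PropositionalEquality.Core as ≡ using (_≡_; _≢_)
open import Relation.Nullary.Decidable.Core using (Dec; yes; no; ¬?)
open import Relation.Nullary.Negation.Core using (¬_; contradiction)
import Algebra.Apartness.Properties.HeytingCommutativeRing as HeytingProperties
import Algebra.Properties.CommutativeMonoid.Sum as CommutativeMonoidSum
import Algebra.Properties.Ring as RingProperties
import Algebra.Properties.Semiring.Mult as Multiples
import Algebra.Solver.Ring.NaturalCoefficients.Default as SemiringSolver
import Relation.Binary.Reasoning.Setoid as ≈-Reasoning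

private variable
  c ℓ ℓ₁ ℓ₂ : Level

module ProductProperties (L : HeytingField c ℓ₁ ℓ₂) where
  open HeytingField L hiding (zero)
  open HeytingCommutativeRing heytingCommutativeRing using (commutativeRing)
  open CommutativeRing commutativeRing using (*-commutativeMonoid; commutativeSemiring)
  open SemiringSolver commutativeSemiring using (solve; _:=_; _:*_)
  open CommutativeMonoidSum *-commutativeMonoid using (∑-distrib-+; sum-cong-≋)
  open FieldOperations L
  open HeytingProperties heytingCommutativeRing using (x-0≈x)
  open ≈-Reasoning setoid

  *-inverse : ∀ y (y#0 : y # 0#) → y * proj₁ (#⇒invertible y#0) ≈ 1#
  *-inverse y y#0 = trans (*-congʳ (sym (x-0≈x y))) (proj₂ (proj₂ (#⇒invertible y#0)))

  /-ratio : ∀ {u v w d} (d#0 : d # 0#) → v * d ≈ u * w → w / d [ d#0 ] * u ≈ v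
  /-ratio {u} {v} {w} {d} d#0 eq = begin
    w * d⁻¹ * u      ≈⟨ solve 3 (λ w i u → w :* i :* u := u :* w :* i) refl w d⁻¹ u ⟩
    u * w * d⁻¹      ≈⟨ *-congʳ eq ⟨
    v * d * d⁻¹      ≈⟨ *-assoc v d d⁻¹ ⟩
    v * (d * d⁻¹)    ≈⟨ *-congˡ (*-inverse d d#0) ⟩
    v * 1#           ≈⟨ *-identityʳ v ⟩
    v                ∎
    where
    d⁻¹ : Carrier
    d⁻¹ = proj₁ (#⇒invertible d#0)

  *⇒/ : ∀ {q u v} (u#0 : u # 0#) → q * u ≈ v → q ≈ v / u [ u#0 ]
  *⇒/ {q} {u} {v} u#0 eq = begin
    q                ≈⟨ *-identityʳ q ⟨
    q * 1#           ≈⟨ *-congˡ (*-inverse u u#0) ⟨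
    q * (u * u⁻¹)    ≈⟨ *-assoc q u u⁻¹ ⟨
    q * u * u⁻¹      ≈⟨ *-congʳ eq ⟩
    v * u⁻¹          ∎
    where
    u⁻¹ : Carrier
    u⁻¹ = proj₁ (#⇒invertible u#0)

  ∏-cong : ∀ {k} {u v : Vector Carrier k} → (∀ i → u i ≈ v i) → ∏ u ≈ ∏ v
  ∏-cong = sum-cong-≋

  ∏-* : ∀ {k} (u v : Vector Carrier k) → ∏ (λ i → u i * v i) ≈ ∏ u * ∏ v
  ∏-* = ∑-distrib-+

  ∏-ratio : ∀ {k} {q u v : Vector Carrier k} → (∀ i → q i * u i ≈ v i) → ∏ q * ∏ u ≈ ∏ v
  ∏-ratio {q = q} {u} eq = trans (sym (∏-* q u)) (∏-cong eq)

  ∏-ratio-at : ∀ {k} i {q} {u v : Vector Carrier k} →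
    q * u i ≈ v i → (∀ j → j ≢ i → u j ≈ v j) → q * ∏ u ≈ ∏ v
  ∏-ratio-at zero {q} eq eqs =
    trans (sym (*-assoc q _ _)) (*-cong eq (∏-cong λ j → eqs (suc j) λ ()))
  ∏-ratio-at (suc i) {q} {u} eq eqs = trans
    (solve 3 (λ q a b → q :* (a :* b) := a :* (q :* b)) refl q (u zero) (∏ (u ∘′ suc)))
    (*-cong (eqs zero λ ()) (∏-ratio-at i eq λ j j≢i → eqs (suc j) λ { ≡.refl → j≢i ≡.refl }))

  ∏-telescope : ∀ k (f : ℕ → Carrier) →
    ∏ {k} (λ i → f (suc (toℕ i))) * f 0 ≈ ∏ {k} (λ i → f (toℕ i)) * f k
  ∏-telescope zero    f = refl
  ∏-telescope (suc k) f = begin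
    f 1 * P * f 0                                       ≈⟨ solve 3 (λ a p b → a :* p :* b := b :* (p :* a)) refl (f 1) P (f 0) ⟩
    f 0 * (P * f 1)                                     ≈⟨ *-congˡ (∏-telescope k (f ∘′ suc)) ⟩
    f 0 * (∏ {k} (λ i → f (suc (toℕ i))) * f (suc k))   ≈⟨ *-assoc _ _ _ ⟨
    f 0 * ∏ {k} (λ i → f (suc (toℕ i))) * f (suc k)     ∎
    where
    P : Carrier
    P = ∏ {k} λ i → f (suc (suc (toℕ i)))

  ∏-preserves : ∀ {k} (Q : Carrier → Set ℓ) → Q 1# → (∀ {u v} → Q u → Q v → Q (u * v)) →
    {u : Vector Carrier k} → (∀ i → Q (u i)) → Q (∏ u)
  ∏-preserves {k = zero}  Q q1 q* qu = q1
  ∏-preserves {k = suc k} Q q1 q* qu = q* (qu zero) (∏-preserves Q q1 q* (λ i → qu (suc i)))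

  module _ {A : Set ℓ} where

    factor-preserves : ∀ {ℓ′} (d : Dec A) (Q : Carrier → Set ℓ′) {f} → Q 1# → (∀ h → Q (f h)) → Q (factor d f)
    factor-preserves (yes h) Q q1 qf = qf h
    factor-preserves (no _)  Q q1 qf = q1

    factor-yes : ∀ {ℓ′} (d : Dec A) (Q : Carrier → Set ℓ′) {f} → A → (∀ h → Q (f h)) → Q (factor d f)
    factor-yes (yes h) Q _ qf = qf h
    factor-yes (no ¬h) Q h qf = contradiction h ¬h

    factor-no : (d : Dec A) {f : A → Carrier} → ¬ A → factor d f ≈ 1#
    factor-no (yes h) ¬h = contradiction h ¬h
    factor-no (no _)  _  = refl

    factor-cong : (d : Dec A) {f f′ : A → Carrier} → (∀ h → f h ≈ f′ h) → factor d f ≈ factor d f′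
    factor-cong (yes h) eq = eq h
    factor-cong (no _)  _  = refl

    factor-ratio : (d : Dec A) {q u v : A → Carrier} →
      (∀ h → q h * u h ≈ v h) → factor d q * factor d u ≈ factor d v
    factor-ratio (yes h) eq = eq h
    factor-ratio (no _)  _  = *-identityˡ 1#

  ∏-< : ∀ {k} → (Fin k → Fin k → Carrier) → Carrier
  ∏-< u = ∏ λ i → ∏-where (Fin._<? i) λ j _ → u i j

  -- Split q into its parts below and above l. The part below scales row l;
  -- the part above scales the entries of column l, one in each later row.
  ∏-<-ratio : ∀ {k} l {q : Vector Carrier k} {u v : Fin k → Fin k → Carrier} →
    q l ≈ 1# →
    (∀ {j} → j Fin.< l → q j * u l j ≈ v l j) →
    (∀ {i} → l Fin.< i → q i * u i l ≈ v i l) →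
    (∀ {i j} → i ≢ l → j ≢ l → u i j ≈ v i j) →
    ∏ q * ∏-< u ≈ ∏-< v
  ∏-<-ratio {k} l {q} {u} {v} ql≈1 row col other = begin
    ∏ q * ∏ (rows u)                        ≈⟨ *-congʳ (trans (∏-cong split) (∏-* below above)) ⟩
    ∏ below * ∏ above * ∏ (rows u)          ≈⟨ *-assoc _ _ _ ⟩
    ∏ below * (∏ above * ∏ (rows u))        ≈⟨ *-congˡ (∏-ratio {q = above} {rows u} λ i → refl) ⟩
    ∏ below * ∏ (λ i → above i * rows u i)  ≈⟨ ∏-ratio-at l row-l row-i ⟩
    ∏ (rows v)                              ∎
    where
    below above : Vector Carrier k
    below j = factor (j Fin.<? l) λ _ → q j
    above i = factor (l Fin.<? i) λ _ → q i

    rows : (Fin k → Fin k → Carrier) → Vector Carrier k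
    rows w i = ∏-where (Fin._<? i) λ j _ → w i j

    split : ∀ j → q j ≈ below j * above j
    split j with <-cmp j l
    ... | tri< j<l _ l≮j = sym (trans
      (*-cong (factor-yes (j Fin.<? l) (_≈ q j) j<l λ _ → refl) (factor-no (l Fin.<? j) l≮j)) (*-identityʳ _))
    ... | tri≈ j≮l ≡.refl l≮j = trans ql≈1 (sym (trans
      (*-cong (factor-no (j Fin.<? l) j≮l) (factor-no (l Fin.<? j) l≮j)) (*-identityʳ _)))
    ... | tri> j≮l _ l<j = sym (trans
      (*-cong (factor-no (j Fin.<? l) j≮l) (factor-yes (l Fin.<? j) (_≈ q j) l<j λ _ → refl)) (*-identityˡ _))

    row-l : ∏ below * (above l * rows u l) ≈ rows v l
    row-l = begin
      ∏ below * (above l * rows u l)    ≈⟨ *-congˡ (*-congʳ (factor-no (l Fin.<? l) (Fin.<-irrefl ≡.refl))) ⟩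
      ∏ below * (1# * rows u l)         ≈⟨ *-congˡ (*-identityˡ _) ⟩
      ∏ below * rows u l                ≈⟨ ∏-ratio (λ j → factor-ratio (j Fin.<? l) λ j<l → row j<l) ⟩
      rows v l                          ∎

    row-i : ∀ i → i ≢ l → above i * rows u i ≈ rows v i
    row-i i i≢l = ∏-ratio-at l
      (factor-ratio (l Fin.<? i) λ l<i → col l<i)
      (λ j j≢l → factor-cong (j Fin.<? i) λ _ → other i≢l j≢l)

module ShiftQuotients (L : HeytingField c ℓ₁ ℓ₂)
  (A : HeytingField.Carrier L) where
  open HeytingField L hiding (zero)
  open HeytingCommutativeRing heytingCommutativeRing using (commutativeRing)
  open CommutativeRing commutativeRing using (ring; commutativeSemiring)
  open RingProperties ring
  open SemiringSolver commutativeSemiring using (solve; _:=_; _:*_; _:+_; con)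
  open FieldOperations L
  open ProductProperties L
  open ≈-Reasoning setoid

  -- The difference equation G(y + A) / G(y) = (y + B) / (y + A), cleared of
  -- denominators.
  Steps : Carrier → (Carrier → Carrier) → Set (c ⊔ ℓ₁)
  Steps B G = ∀ y → G (y + A) * (y + A) ≈ G y * (y + B)

  ∏-steps : ∀ k (w : ℕ → Carrier) → w 0 ≈ 0# → (∀ i → w (suc i) ≈ A + w i) →
    Steps (w (suc k)) λ y → ∏ {k} λ i → y + w (suc (toℕ i))
  ∏-steps k w w0≈0 w-suc y = begin
    ∏ {k} (λ i → y + A + w (suc (toℕ i))) * (y + A)
      ≈⟨ *-cong (∏-cong {k} λ i → shift (suc (toℕ i))) (trans (sym (+-identityʳ _)) (trans (+-congˡ (sym w0≈0)) (shift 0))) ⟩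
    ∏ {k} (λ i → y + w (suc (suc (toℕ i)))) * (y + w 1)
      ≈⟨ ∏-telescope k (λ i → y + w (suc i)) ⟩
    ∏ {k} (λ i → y + w (suc (toℕ i))) * (y + w (suc k)) ∎
    where
    shift : ∀ i → y + A + w i ≈ y + w (suc i)
    shift i = trans (+-assoc y A (w i)) (+-congˡ (sym (w-suc i)))

  x-y+y≈x : ∀ x y → x - y + y ≈ x
  x-y+y≈x x y = trans (+-assoc x (- y) y) (trans (+-congˡ (-‿inverseˡ y)) (+-identityʳ x))

  x-[y+A]+A≈x-y : ∀ x y → x - (y + A) + A ≈ x - y
  x-[y+A]+A≈x-y x y = begin
    x - (y + A) + A        ≈⟨ +-congʳ (+-congˡ (-‿+-comm y A)) ⟨
    x + (- y - A) + A      ≈⟨ +-congʳ (+-assoc x (- y) (- A)) ⟨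
    x - y - A + A          ≈⟨ x-y+y≈x (x - y) A ⟩
    x - y                  ∎

  x-y+A≈[x+A]-y : ∀ x y → x - y + A ≈ x + A - y
  x-y+A≈[x+A]-y x y = solve 3 (λ x y A → x :+ y :+ A := x :+ A :+ y) refl x (- y) A

  -x*-y≈x*y : ∀ x y → - x * - y ≈ x * y
  -x*-y≈x*y x y = trans (sym (-‿distribˡ-* x (- y))) (trans (-‿cong (sym (-‿distribʳ-* x y))) (-‿involutive (x * y)))

  module Antisymmetric (H : Carrier → Carrier) (H-cong : ∀ {y z} → y ≈ z → H y ≈ H z)
    (H-steps : Steps (- (1# + 1#)) H) where

    h : Carrier → Carrier
    h y = y * H (y + 1#)

    h-cong : ∀ {y z} → y ≈ z → h y ≈ h z
    h-cong eq = *-cong eq (H-cong (+-congʳ eq))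

    h-steps : ∀ y → h (y + A) * (y * (y + 1# + A)) ≈ h y * ((y + A) * (y - 1#))
    h-steps y = begin
      (y + A) * H (y + A + 1#) * (y * (y + 1# + A))
        ≈⟨ *-congʳ (*-congˡ (H-cong (solve 2 (λ y A → y :+ A :+ con 1 := y :+ con 1 :+ A) refl y A))) ⟩
      (y + A) * H (y + 1# + A) * (y * (y + 1# + A))
        ≈⟨ solve 4 (λ s H y t → s :* H :* (y :* t) := y :* s :* (H :* t)) refl (y + A) (H (y + 1# + A)) y (y + 1# + A) ⟩
      y * (y + A) * (H (y + 1# + A) * (y + 1# + A))
        ≈⟨ *-congˡ (H-steps (y + 1#)) ⟩
      y * (y + A) * (H (y + 1#) * (y + 1# - (1# + 1#)))
        ≈⟨ *-congˡ (*-congˡ y+1-2≈y-1) ⟩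
      y * (y + A) * (H (y + 1#) * (y - 1#))
        ≈⟨ solve 4 (λ s H y t → y :* s :* (H :* t) := y :* H :* (s :* t)) refl (y + A) (H (y + 1#)) y (y - 1#) ⟩
      h y * ((y + A) * (y - 1#)) ∎
      where
      y+1-2≈y-1 : y + 1# - (1# + 1#) ≈ y - 1#
      y+1-2≈y-1 = begin
        y + 1# - (1# + 1#)          ≈⟨ +-congˡ (-‿+-comm 1# 1#) ⟨
        y + 1# + (- 1# - 1#)        ≈⟨ +-assoc (y + 1#) (- 1#) (- 1#) ⟨
        y + 1# - 1# - 1#            ≈⟨ +-congʳ (trans (+-assoc y 1# (- 1#)) (trans (+-congˡ (-‿inverseʳ 1#)) (+-identityʳ y))) ⟩
        y - 1#                      ∎

    h-steps-back : ∀ {y z} → - (y + A) ≈ z →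
      h y * (z * (z + 1# + A)) ≈ h (y + A) * ((z + A) * (z - 1#))
    h-steps-back {y} {z} eq = begin
      h y * (z * (z + 1# + A))                       ≈⟨ *-congˡ (*-cong eq eq₂) ⟨
      h y * (- (y + A) * - (y - 1#))                 ≈⟨ *-congˡ (-x*-y≈x*y _ _) ⟩
      h y * ((y + A) * (y - 1#))                     ≈⟨ h-steps y ⟨
      h (y + A) * (y * (y + 1# + A))                 ≈⟨ *-congˡ (-x*-y≈x*y _ _) ⟨
      h (y + A) * (- y * - (y + 1# + A))             ≈⟨ *-congˡ (*-cong eq₁ eq₃) ⟩
      h (y + A) * ((z + A) * (z - 1#))               ∎
      where
      eq₁ : - y ≈ z + A
      eq₁ = begin
        - y              ≈⟨ x-y+y≈x (- y) A ⟨
        - y - A + A      ≈⟨ +-congʳ (-‿+-comm y A) ⟩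
        - (y + A) + A    ≈⟨ +-congʳ eq ⟩
        z + A            ∎
      eq₂ : - (y - 1#) ≈ z + 1# + A
      eq₂ = begin
        - (y - 1#)       ≈⟨ -‿+-comm y (- 1#) ⟨
        - y - (- 1#)     ≈⟨ +-cong eq₁ (-‿involutive 1#) ⟩
        z + A + 1#       ≈⟨ solve 2 (λ z A → z :+ A :+ con 1 := z :+ con 1 :+ A) refl z A ⟩
        z + 1# + A       ∎
      eq₃ : - (y + 1# + A) ≈ z - 1#
      eq₃ = begin
        - (y + 1# + A)      ≈⟨ -‿cong (solve 2 (λ y A → y :+ con 1 :+ A := y :+ A :+ con 1) refl y A) ⟩
        - (y + A + 1#)      ≈⟨ -‿+-comm (y + A) 1# ⟨
        - (y + A) - 1#      ≈⟨ +-congʳ eq ⟩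
        z - 1#              ∎

  _[_]+A : ∀ {k} → Vector Carrier k → Fin k → Vector Carrier k
  v [ i ]+A = updateAt v i (_+ A)

  module _ {k} (v : Vector Carrier k) where

    shifted : ∀ i → (v [ i ]+A) i ≈ v i + A
    shifted i = reflexive (updateAt-updates i v)

    unshifted : ∀ {i j} → j ≢ i → v j ≈ (v [ i ]+A) j
    unshifted {i} {j} j≢i = reflexive (≡.sym (updateAt-minimal j i v j≢i))

  -‿-cong : ∀ {w x y z} → w ≈ x → y ≈ z → w - y ≈ x - z
  -‿-cong eq eq′ = +-cong eq (-‿cong eq′)

  module Master {n r : ℕ}
    (B : Vector Carrier n)
    (G : Fin n → Carrier → Carrier) (G-cong : ∀ m {y z} → y ≈ z → G m y ≈ G m z)
    (G-steps : ∀ m → Steps (B m) (G m))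
    (H : Carrier → Carrier) (H-cong : ∀ {y z} → y ≈ z → H y ≈ H z)
    (H-steps : Steps (- (1# + 1#)) H)
    (σ : Vector Carrier r) (ξ : Vector Carrier n) where

    open Antisymmetric H H-cong H-steps

    mixed : Vector Carrier r → Vector Carrier n → Carrier
    mixed σ ξ = ∏ λ m → ∏ λ l → G m (σ l - ξ m)

    antisymmetric : Vector Carrier r → Carrier
    antisymmetric σ = ∏-< λ l j → h (σ l - σ j)

    module _ (l : Fin r)
      (mixed#0 : ∀ m → σ l - ξ m + A # 0#)
      (antisymmetric#0 : ∀ {j} → j ≢ l → (σ l - σ j) * (σ l - σ j + 1# + A) # 0#)
      where

      mixed-ratio : ∏ (λ m → (σ l - ξ m + B m) / (σ l - ξ m + A) [ mixed#0 m ]) * mixed σ ξ ≈ mixed (σ [ l ]+A) ξ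
      mixed-ratio = ∏-ratio λ m → ∏-ratio-at l
        (trans (/-ratio (mixed#0 m) (G-steps m (σ l - ξ m)))
          (G-cong m (trans (x-y+A≈[x+A]-y (σ l) (ξ m)) (+-congʳ (sym (shifted σ l))))))
        (λ j j≢l → G-cong m (+-congʳ (unshifted σ j≢l)))

      ratio : ∀ j → j ≢ l → Carrier
      ratio j j≢l = ((σ l - σ j + A) * (σ l - σ j - 1#)) / ((σ l - σ j) * (σ l - σ j + 1# + A)) [ antisymmetric#0 j≢l ]

      antisymmetric-ratio : ∏-where (λ j → ¬? (j Fin.≟ l)) ratio * antisymmetric σ ≈ antisymmetric (σ [ l ]+A)
      antisymmetric-ratio = ∏-<-ratio l {λ j → factor (¬? (j Fin.≟ l)) (ratio j)}
        (factor-no (¬? (l Fin.≟ l)) λ l≢l → l≢l ≡.refl)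
        (λ {j} j<l → factor-yes (¬? (j Fin.≟ l)) (λ q → q * _ ≈ _) (<⇒≢ j<l) λ j≢l →
          trans (/-ratio (antisymmetric#0 j≢l) (h-steps (σ l - σ j)))
            (h-cong (trans (x-y+A≈[x+A]-y (σ l) (σ j)) (-‿-cong (sym (shifted σ l)) (unshifted σ j≢l)))))
        (λ {i} l<i → factor-yes (¬? (i Fin.≟ l)) (λ q → q * _ ≈ _) (≡.≢-sym (<⇒≢ l<i)) λ i≢l →
          trans (*-congˡ (h-cong (sym (x-[y+A]+A≈x-y (σ i) (σ l)))))
            (trans (/-ratio (antisymmetric#0 i≢l) (h-steps-back
              (trans (-‿cong (x-[y+A]+A≈x-y (σ i) (σ l))) (⁻¹-anti-homo‿- (σ i) (σ l)))))
            (h-cong (-‿-cong (unshifted σ i≢l) (sym (shifted σ l))))))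
        (λ i≢l j≢l → h-cong (-‿-cong (unshifted σ i≢l) (unshifted σ j≢l)))

      Φ-ratio :
        ∏ (λ m → (σ l - ξ m + B m) / (σ l - ξ m + A) [ mixed#0 m ]) * ∏-where (λ j → ¬? (j Fin.≟ l)) ratio
          * (mixed σ ξ * antisymmetric σ)
        ≈ mixed (σ [ l ]+A) ξ * antisymmetric (σ [ l ]+A)
      Φ-ratio = trans
        (solve 4 (λ p q u v → p :* q :* (u :* v) := (p :* u) :* (q :* v)) refl _ _ _ _)
        (*-cong mixed-ratio antisymmetric-ratio)

    module _ (m : Fin n) (ψ#0 : ∀ l → σ l - ξ m + B m - A # 0#) where

      ψ-step : ∀ l → (σ l - ξ m) / (σ l - ξ m + B m - A) [ ψ#0 l ] * G m (σ l - ξ m) ≈ G m (σ l - (ξ [ m ]+A) m)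
      ψ-step l = /-ratio (ψ#0 l) (begin
        G m (σ l - (ξ [ m ]+A) m) * (σ l - ξ m + B m - A)    ≈⟨ *-cong (G-cong m (+-congˡ (-‿cong (shifted ξ m)))) denominator ⟩
        G m y * (y + B m)                                    ≈⟨ G-steps m y ⟨
        G m (y + A) * (y + A)                                ≈⟨ *-cong (G-cong m y+A) y+A ⟩
        G m (σ l - ξ m) * (σ l - ξ m)                        ∎)
        where
        y : Carrier
        y = σ l - (ξ m + A)
        y+A : y + A ≈ σ l - ξ m
        y+A = x-[y+A]+A≈x-y (σ l) (ξ m)
        denominator : σ l - ξ m + B m - A ≈ y + B m
        denominator = begin
          σ l - ξ m + B m - A        ≈⟨ solve 4 (λ s x b a → s :+ x :+ b :+ a := s :+ (x :+ a) :+ b) refl (σ l) (- ξ m) (B m) (- A) ⟩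
          σ l + (- ξ m - A) + B m    ≈⟨ +-congʳ (+-congˡ (-‿+-comm (ξ m) A)) ⟩
          y + B m                    ∎

      Ψ-ratio : ∏ (λ l → (σ l - ξ m) / (σ l - ξ m + B m - A) [ ψ#0 l ]) * (mixed σ ξ * antisymmetric σ)
        ≈ mixed σ (ξ [ m ]+A) * antisymmetric σ
      Ψ-ratio = trans (sym (*-assoc _ _ _)) (*-congʳ (∏-ratio-at m
        (∏-ratio ψ-step)
        (λ j j≢m → ∏-cong {r} λ l → G-cong j (+-congˡ (-‿cong (unshifted ξ j≢m))))))

module MasterFunctionProperties
  (K : HeytingField c ℓ₁ ℓ₂)
  (p : ℕ) (char : PrimeSubfield.HasCharacteristic K p) (p>2 : 2 < p)
  (n r : ℕ)
  (Λ : Fin n → HeytingField.Carrier K) (Λ∈ : ∀ m → PrimeSubfield.InPrimeSubfield K (Λ m))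
  (a : HeytingField.Carrier K) (a∈ : PrimeSubfield.InPrimeSubfield K a)
  (a#0 : HeytingField._#_ K a (HeytingField.0# K))
  where

  private
    module K = HeytingField K
    module KR = CommutativeRing (HeytingCommutativeRing.commutativeRing K.heytingCommutativeRing)
  open PrimeSubfield K
  open MasterFunction K p char p>2 n r Λ Λ∈ a a∈ a#0
  open Polynomials (fieldDomain K)
  open Fractions K[s,x] using (frac; frac-cong; frac-+; cross)
  private module D = ApartnessDomain K[s,x]
  open HeytingField K⟨s,x⟩
  open HeytingProperties heytingCommutativeRing using (x#0y#0→xy#0; 1#0)
  open FieldOperations K⟨s,x⟩
  open ProductProperties K⟨s,x⟩
  open ShiftQuotients K⟨s,x⟩ (ι a)
  open ≈-Reasoning setoid

  frac-* : ∀ u v → frac (u D.* v) ≈ frac u * frac v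
  frac-* u v = cross (D.*-congˡ (D.*-identityˡ D.1#))

  ι-cong : ∀ {k k′} → k K.≈ k′ → ι k ≈ ι k′
  ι-cong e = frac-cong (const-cong N e)

  ι-0 : ι K.0# ≈ 0#
  ι-0 = frac-cong (const-0 N)

  ι-1 : ι K.1# ≈ 1#
  ι-1 = frac-cong (const-1 N)

  ι-neg : ∀ k → ι (K.- k) ≈ - ι k
  ι-neg k = frac-cong (const-neg N k)

  ι-[-2] : ι (K.- (K.1# K.+ K.1#)) ≈ - (1# + 1#)
  ι-[-2] = trans (ι-neg _) (-‿cong (trans (ι-+ K.1# K.1#) (+-cong ι-1 ι-1)))

  g-cong : ∀ {y z} b (b∈ : InPrimeSubfield b) → y ≈ z → g y b b∈ ≈ g z b b∈
  g-cong b b∈ eq = ∏-cong {ℕ.pred (bar b∈)} λ i → +-congʳ eq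

  1+pred-bar : ∀ {b} (b∈ : InPrimeSubfield b) → suc (ℕ.pred (bar b∈)) ≡ bar b∈
  1+pred-bar b∈ = ℕ.suc-pred (bar b∈)
    {{ℕ.>-nonZero (proj₁ (proj₂ (quotient {p} char (ℕ.<-trans (ℕ.s≤s ℕ.z≤n) p>2) a∈ a#0 b∈)))}}

  bar×a : ∀ {b} (b∈ : InPrimeSubfield b) → bar b∈ ℕ× a K.≈ b
  bar×a {b} b∈ = K.trans (K.sym (K.trans (Multiples.×-comm-* KR.semiring (bar b∈) a K.1#)
      (Multiples.×-congʳ KR.semiring (bar b∈) (K.*-identityʳ a))))
    (proj₂ (proj₂ (proj₂ (quotient {p} char (ℕ.<-trans (ℕ.s≤s ℕ.z≤n) p>2) a∈ a#0 b∈))))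

  g-steps : ∀ b (b∈ : InPrimeSubfield b) → Steps (ι b) λ y → g y b b∈
  g-steps b b∈ y = trans
    (∏-steps (ℕ.pred (bar b∈)) (λ i → ι (i ℕ× a)) ι-0 (λ i → ι-+ a (i ℕ× a)) y)
    (*-congˡ (+-congˡ (ι-cong (K.trans (×-congˡ (1+pred-bar b∈)) (bar×a b∈)))))

  private
    module M = Master {n} {r} (λ m → ι (Λ m))
      (λ m y → g y (Λ m) (Λ∈ m)) (λ m → g-cong (Λ m) (Λ∈ m)) (λ m → g-steps (Λ m) (Λ∈ m))
      (λ y → g y (K.- (K.1# K.+ K.1#)) (-2∈ {p} char p>2))
      (g-cong _ (-2∈ {p} char p>2))
      (λ y → trans (g-steps _ (-2∈ {p} char p>2) y) (*-congˡ (+-congˡ ι-[-2])))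
      s x

  F-preserves : ∀ {ℓ} (Q : Carrier → Set ℓ) → Q 1# → (∀ {u v} → Q u → Q v → Q (u * v)) →
    (∀ l m i → Q (s l - x m + ι i)) →
    (∀ {l j} → j ≢ l → Q (s l - s j)) →
    (∀ {l j} i → j ≢ l → Q (s l - s j + 1# + ι i)) →
    Q (F s x)
  F-preserves Q q1 q* qsx qss qss1 = q*
    (∏-preserves Q q1 q* λ m → ∏-preserves Q q1 q* λ l → ∏-preserves {k = ℕ.pred (bar (Λ∈ m))} Q q1 q* λ i →
      qsx l m (suc (toℕ i) ℕ× a))
    (∏-preserves Q q1 q* λ l → ∏-preserves Q q1 q* λ j → factor-preserves (j Fin.<? l) Q q1 λ j<l →
      q* (qss (<⇒≢ j<l)) (∏-preserves {k = ℕ.pred (bar (-2∈ {p} char p>2))} Q q1 q* λ i →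
        qss1 (suc (toℕ i) ℕ× a) (<⇒≢ j<l)))

  F#0 : F s x # 0#
  F#0 = F-preserves (_# 0#) 1#0 (λ {u} {v} → x#0y#0→xy#0 {u} {v})
    (λ l m i → linear# (l ↑ˡ n) (r ↑ʳ m) i (s≢x l m)) s-s#0 s-s+1+ι#0
    where
    s-s+1+ι#0 : ∀ {l j} k → j ≢ l → s l - s j + 1# + ι k # 0#
    s-s+1+ι#0 {l} {j} k j≢l = #0-cong (begin
      s l - s j + ι (K.1# K.+ k)      ≈⟨ +-congˡ (ι-+ K.1# k) ⟩
      s l - s j + (ι K.1# + ι k)      ≈⟨ +-congˡ (+-congʳ ι-1) ⟩
      s l - s j + (1# + ι k)          ≈⟨ +-assoc (s l - s j) 1# (ι k) ⟨
      s l - s j + 1# + ι k            ∎)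
      (linear# (l ↑ˡ n) (j ↑ˡ n) (K.1# K.+ k) (s≢s j≢l))

  IsPolynomial-+ : ∀ {u v} → IsPolynomial u → IsPolynomial v → IsPolynomial (u + v)
  IsPolynomial-+ (P , eq) (Q , eq′) = P D.+ Q , trans (+-cong eq eq′) (sym (frac-+ P Q))

  IsPolynomial-* : ∀ {u v} → IsPolynomial u → IsPolynomial v → IsPolynomial (u * v)
  IsPolynomial-* (P , eq) (Q , eq′) = P D.* Q , trans (*-cong eq eq′) (sym (frac-* P Q))

  IsPolynomial-frac : ∀ P → IsPolynomial (frac P)
  IsPolynomial-frac P = P , refl

  F-isPolynomial : IsPolynomial (F s x)
  F-isPolynomial = F-preserves IsPolynomial (IsPolynomial-frac D.1#) IsPolynomial-*
    (λ l m i → IsPolynomial-+ (difference (l ↑ˡ n) (r ↑ʳ m)) (IsPolynomial-frac (const N i)))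
    (λ {l} {j} _ → difference (l ↑ˡ n) (j ↑ˡ n))
    (λ {l} {j} i _ → IsPolynomial-+
      (IsPolynomial-+ (difference (l ↑ˡ n) (j ↑ˡ n)) (IsPolynomial-frac D.1#)) (IsPolynomial-frac (const N i)))
    where
    difference : ∀ i j → IsPolynomial (frac (var N i) - frac (var N j))
    difference i j = IsPolynomial-+ (IsPolynomial-frac (var N i)) (IsPolynomial-frac (D.- var N j))

  Φ-quotient : ∀ l → Φ l ≈ F (s +a[ l ]) x / F s x [ F#0 ]
  Φ-quotient l = *⇒/ F#0 (M.Φ-ratio l (s-x+a#0 l) Φ-denominator#0)

  Ψ-quotient : ∀ m → Ψ m ≈ F s (x +a[ m ]) / F s x [ F#0 ]
  Ψ-quotient m = *⇒/ F#0 (M.Ψ-ratio m λ l → s-x+Λ-a#0 l m)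

lemma7p1 : ∀ {c ℓ₁ ℓ₂} (K : HeytingField c ℓ₁ ℓ₂) →
  let module K = HeytingField K
      open PrimeSubfield K in
  (p : ℕ) (char : HasCharacteristic p) (p>2 : 2 < p) →
  (n r : ℕ) → 1 ≤ n → 1 ≤ r →
  (Λ : Fin n → K.Carrier) (Λ∈ : ∀ m → InPrimeSubfield (Λ m)) →
  (a : K.Carrier) (a∈ : InPrimeSubfield a) (a#0 : a K.# K.0#) →
  let open MasterFunction K p char p>2 n r Λ Λ∈ a a∈ a#0
      module L = HeytingField K⟨s,x⟩
      open FieldOperations K⟨s,x⟩ using (_/_[_]) in
  IsPolynomial (F s x) ×
  (Σ[ F#0 ∈ F s x L.# L.0# ]
    (∀ l → Φ l L.≈ F (s +a[ l ]) x / F s x [ F#0 ]) ×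
    (∀ m → Ψ m L.≈ F s (x +a[ m ]) / F s x [ F#0 ]))
lemma7p1 K p char p>2 n r _ _ Λ Λ∈ a a∈ a#0 = F-isPolynomial , F#0 , Φ-quotient , Ψ-quotient
  where open MasterFunctionProperties K p char p>2 n r Λ Λ∈ a a∈ a#0
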